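{- Let $r,p,s$ be positive integers such that $s$ and $p$ divide $r$, and let $d=sp/\gcd(sp,r)$ (so that $G(r,p,s,n)$ is defined exactly when $d\mid n$). Then the following identity of formal power series in $u,q_1,q_2$ holds up to terms of degree $0$ in $u$ (that is, the coefficients of $u^n$ on both sides agree for every $n\ge 1$): $$\sum_{n\ge 1,\ d\mid n}u^n\,\mathrm{Hilb}\big(S_s[X,Y]^{\Delta G(r,p,s,n)}\big)(q_1,q_2)=\Bigg\{\sum_{l=0}^{p-1}\ \prod_{\substack{i,j\ge 0\\ i+j\equiv l\frac{r}{p}\ \mathrm{mod}\ r}}\frac{1}{1-u\,q_1^{i}q_2^{j}}\Bigg\}_{u^dq_1^s}.$$
   Context: Notation. For a power series $F$, $\{F\}_{u^dq_1^s}$ is obtained from $F$ by discarding all terms whose degree in $u$ is not divisible by $d$ or whose degree in $q_1$ is not divisible by $s$. Groups. $G(r,n)$ is the group of $n\times n$ complex matrices with exactly one nonzero entry in each row and column, the nonzero entries being $r$-th roots of unity. For $p\mid r$, $G(r,p,n)$ is the subgroup of the matrices $A\in G(r,n)$ such that $\det A/\det|A|$ is an $\frac{r}{p}$-th root of unity, where $|A|$ is the matrix of absolute values of the entries of $A$. For $s\mid r$ with $ps\mid rn$, $G(r,p,n)$ contains the cyclic group $C_s$ of scalar matrices generated by $e^{2\pi i/s}I$, and $G(r,p,s,n)=G(r,p,n)/C_s$. Invariants. $S_s[X,Y]$ is the subalgebra of $\mathbb C[x_1,\ldots,x_n,y_1,\ldots,y_n]$ generated by $1$ and the monomials whose degree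 in the $x$-variables and whose degree in the $y$-variables are both divisible by $s$. The group $G(r,p,n)$ acts on $\mathbb C[x_1,\ldots,x_n,y_1,\ldots,y_n]$ diagonally, i.e. by the same linear substitution on $x_1,\ldots,x_n$ and on $y_1,\ldots,y_n$; since $C_s$ acts trivially on $S_s[X,Y]$, this induces an action of $G(r,p,s,n)$ on $S_s[X,Y]$ (the action of the diagonal subgroup $\Delta G(r,p,s,n)\subset G(r,p,s,n)\times G(r,p,s,n)$), whose invariant algebra is $S_s[X,Y]^{\Delta G(r,p,s,n)}$. $\mathrm{Hilb}(A)(q_1,q_2)=\sum_{a,b\ge 0}\dim(A_{a,b})\,q_1^aq_2^b$, where $A_{a,b}$ is the subspace of elements of degree $a$ in the $x$-variables and $b$ in the $y$-variables. -}

module Defs where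

open import Level using (Level; _⊔_)
open import Algebra.Apartness.Bundles using (HeytingCommutativeRing; HeytingField)
open import Algebra.Bundles using (CommutativeRing)
open import Data.Bool.Base using (true; false; if_then_else_)
open import Data.Bool.Properties using (∧-zeroʳ)
open import Data.Fin.Base using (Fin; zero; suc; toℕ; punchIn)
import Data.Fin.Properties as Fin
open import Data.List.Base as List
  using (List; []; _∷_; _++_; applyDownFrom; concatMap; cartesianProductWith)
open import Data.Nat.Base hiding (_⊔_; _^_)
open import Data.Nat.DivMod using (_/_; _%_; m/n*n≡m)
open import Data.Nat.Divisibility using (_∣_; _∣?_)
open import Data.Nat.GCD using (gcd; gcd[m,n]≢0)
open import Data.Nat.ListAction using (sum)
open import Data.Nat.Properties
open import Data.Product.Base using (Σ; Σ-syntax; ∃-syntax; _×_; _,_; proj₁; proj₂)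
open import Data.Product.Properties as Product using ()
open import Data.Sum.Base using (_⊎_; inj₁; inj₂)
open import Data.Vec.Base as Vec using (Vec; replicate; zipWith; _[_]≔_)
import Data.Vec.Properties as Vec
import Data.Vec.Functional as Vector
open import Relation.Binary.Bundles using (Setoid)
open import Relation.Binary.Definitions using (DecidableEquality)
open import Relation.Binary.PropositionalEquality
  using (_≡_; _≢_; refl; sym; trans; cong; cong₂; module ≡-Reasoning)
open import Relation.Nullary using (¬_; does; _×-dec_)
open import Relation.Nullary.Decidable using (dec-false)

------------------------------------------------------------------------
-- Formal power series in u, q₁, q₂: F n a b is the coefficient of
-- uⁿ q₁ᵃ q₂ᵇ.  All the series involved have natural coefficients.

FPS : Set
FPS = ℕ → ℕ → ℕ → ℕ

infixl 7 _*ₛ_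

Σ< : ℕ → (ℕ → ℕ) → ℕ
Σ< k f = sum (applyDownFrom f k)

1ₛ : FPS
1ₛ 0 0 0 = 1
1ₛ _ _ _ = 0

_*ₛ_ : FPS → FPS → FPS
(F *ₛ G) n a b =
  Σ< (suc n) λ i → Σ< (suc a) λ j → Σ< (suc b) λ k →
    F i j k * G (n ∸ i) (a ∸ j) (b ∸ k)

Σₛ : ℕ → (ℕ → FPS) → FPS
Σₛ k F n a b = Σ< k λ l → F l n a b

∏ₛ : ℕ → (ℕ → FPS) → FPS
∏ₛ k F = List.foldr _*ₛ_ 1ₛ (applyDownFrom F k)

-- 1 / (1 - u q₁ⁱ q₂ʲ) = Σₖ uᵏ q₁ᵏⁱ q₂ᵏʲ
1/[1-uq₁^_q₂^_] : ℕ → ℕ → FPS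
1/[1-uq₁^ i q₂^ j ] n a b =
  if does ((a ≟ n * i) ×-dec (b ≟ n * j)) then 1 else 0

-- The infinite product ∏_{i,j≥0} F i j, for families in which every term of
-- F i j other than 1 has degree at least i in q₁ and at least j in q₂.  Its
-- coefficient at uⁿ q₁ᵃ q₂ᵇ is that of the partial product over i ≤ a, j ≤ b;
-- ∏∞-limit below shows that all larger partial products have the same one.
∏∞ : (ℕ → ℕ → FPS) → FPS
∏∞ F n a b = ∏ₛ (suc a) (λ i → ∏ₛ (suc b) (λ j → F i j)) n a b

-- {F}_{uᵈ q₁ˢ}
truncate : ℕ → ℕ → FPS → FPS
truncate d s F n a b = if does ((d ∣? n) ×-dec (s ∣? a)) then F n a b else 0

-- Σ_{n ≥ 1, d ∣ n} uⁿ H n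
Σ[n≥1,_∣n]uⁿ : ℕ → (ℕ → ℕ → ℕ → ℕ) → FPS
Σ[n≥1, d ∣n]uⁿ H n a b = if does ((1 ≤? n) ×-dec (d ∣? n)) then H n a b else 0

-- 1 / (1 - u q₁ⁱ q₂ʲ) if i + j ≡ l r/p (mod r), and no factor (i.e. 1) otherwise
factor : (r p : ℕ) .{{_ : NonZero r}} .{{_ : NonZero p}} → ℕ → ℕ → ℕ → FPS
factor r p l i j =
  if does ((i + j) % r ≟ (l * (r / p)) % r) then 1/[1-uq₁^ i q₂^ j ] else 1ₛ

d⟨_,_,_⟩ : (r p s : ℕ) .{{_ : NonZero r}} → ℕ
d⟨ r , p , s ⟩ = (s * p) / gcd (s * p) r
  where instance
  gcd≢0 : NonZero (gcd (s * p) r)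
  gcd≢0 = ≢-nonZero (gcd[m,n]≢0 (s * p) r (inj₂ (≢-nonZero⁻¹ r)))

------------------------------------------------------------------------
-- The partial products are eventually constant in each coefficient

Admissible : (ℕ → ℕ → FPS) → Set
Admissible F = ∀ i j n a b → a < i ⊎ b < j → F i j n a b ≡ 1ₛ n a b

private
  Σ<-cong : ∀ k {f g : ℕ → ℕ} → (∀ i → f i ≡ g i) → Σ< k f ≡ Σ< k g
  Σ<-cong zero    f≡g = refl
  Σ<-cong (suc k) f≡g = cong₂ _+_ (f≡g k) (Σ<-cong k f≡g)

  Σ<-zero : ∀ k {f : ℕ → ℕ} → (∀ i → i < k → f i ≡ 0) → Σ< k f ≡ 0
  Σ<-zero zero    f≡0 = refl
  Σ<-zero (suc k) f≡0 =
    cong₂ _+_ (f≡0 k ≤-refl) (Σ<-zero k λ i i<k → f≡0 i (m<n⇒m<1+n i<k))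

  Σ<-last : ∀ k {f : ℕ → ℕ} → (∀ i → i < k → f i ≡ 0) → Σ< (suc k) f ≡ f k
  Σ<-last k {f} f≡0 = trans (cong (f k +_) (Σ<-zero k f≡0)) (+-identityʳ (f k))

  Σ<-first : ∀ k {f : ℕ → ℕ} → (∀ i → f (suc i) ≡ 0) → Σ< (suc k) f ≡ f 0
  Σ<-first zero    {f} f≡0 = +-identityʳ (f 0)
  Σ<-first (suc k) {f} f≡0 = cong₂ _+_ (f≡0 k) (Σ<-first k f≡0)

  -- Only the coefficients in the box below (n , a , b) matter to a product
  box-cong : ∀ n a b {F F′ G G′ : FPS} →
    (∀ i j k → j ≤ a → k ≤ b → F i j k ≡ F′ i j k) →
    (∀ i j k → j ≤ a → k ≤ b → G i j k ≡ G′ i j k) →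
    (F *ₛ G) n a b ≡ (F′ *ₛ G′) n a b
  box-cong n a b F≡ G≡ =
    Σ<-cong (suc n) λ i → Σ<-cong′ (suc a) λ j j<1+a → Σ<-cong′ (suc b) λ k k<1+b →
      cong₂ _*_ (F≡ i j k (s≤s⁻¹ j<1+a) (s≤s⁻¹ k<1+b))
                (G≡ (n ∸ i) (a ∸ j) (b ∸ k) (m∸n≤m a j) (m∸n≤m b k))
    where
    Σ<-cong′ : ∀ m {f g : ℕ → ℕ} → (∀ i → i < m → f i ≡ g i) → Σ< m f ≡ Σ< m g
    Σ<-cong′ zero    f≡g = refl
    Σ<-cong′ (suc m) f≡g =
      cong₂ _+_ (f≡g m ≤-refl) (Σ<-cong′ m λ i i<m → f≡g i (m<n⇒m<1+n i<m))

  *ₛ-identityˡ : ∀ G n a b → (1ₛ *ₛ G) n a b ≡ G n a b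
  *ₛ-identityˡ G n a b = begin
    (1ₛ *ₛ G) n a b
      ≡⟨ Σ<-first n (λ i → Σ<-zero (suc a) λ j _ → Σ<-zero (suc b) λ k _ → refl) ⟩
    (Σ< (suc a) λ j → Σ< (suc b) λ k → 1ₛ 0 j k * G n (a ∸ j) (b ∸ k))
      ≡⟨ Σ<-first a (λ j → Σ<-zero (suc b) λ k _ → refl) ⟩
    (Σ< (suc b) λ k → 1ₛ 0 0 k * G n a (b ∸ k))
      ≡⟨ Σ<-first b (λ k → refl) ⟩
    1 * G n a b
      ≡⟨ *-identityˡ (G n a b) ⟩
    G n a b ∎
    where open ≡-Reasoning

  ∏ₛ-cong : ∀ k {F F′ : ℕ → FPS} a b →
    (∀ l n i j → i ≤ a → j ≤ b → F l n i j ≡ F′ l n i j) →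
    ∀ n → ∏ₛ k F n a b ≡ ∏ₛ k F′ n a b
  ∏ₛ-cong zero    a b F≡ n = refl
  ∏ₛ-cong (suc k) a b F≡ n = box-cong n a b
    (λ m i j → F≡ k m i j)
    (λ m i j i≤a j≤b → ∏ₛ-cong k i j
      (λ l m′ i′ j′ p q → F≡ l m′ i′ j′ (≤-trans p i≤a) (≤-trans q j≤b)) m)

  ∏ₛ-extend : ∀ {k k′} (F : ℕ → FPS) a b → k ≤′ k′ →
    (∀ l n i j → k ≤ l → i ≤ a → j ≤ b → F l n i j ≡ 1ₛ n i j) →
    ∀ n → ∏ₛ k′ F n a b ≡ ∏ₛ k F n a b
  ∏ₛ-extend F a b ≤′-refl F≡1 n = refl
  ∏ₛ-extend {k} {suc k′} F a b (≤′-step k≤k′) F≡1 n = begin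
    (F k′ *ₛ ∏ₛ k′ F) n a b
      ≡⟨ box-cong n a b {G = ∏ₛ k′ F}
           (λ m i j → F≡1 k′ m i j (≤′⇒≤ k≤k′)) (λ _ _ _ _ _ → refl) ⟩
    (1ₛ *ₛ ∏ₛ k′ F) n a b
      ≡⟨ *ₛ-identityˡ (∏ₛ k′ F) n a b ⟩
    ∏ₛ k′ F n a b
      ≡⟨ ∏ₛ-extend F a b k≤k′ F≡1 n ⟩
    ∏ₛ k F n a b ∎
    where open ≡-Reasoning

  ∏ₛ-one : ∀ k (F : ℕ → FPS) a b →
    (∀ l n i j → i ≤ a → j ≤ b → F l n i j ≡ 1ₛ n i j) →
    ∀ n → ∏ₛ k F n a b ≡ 1ₛ n a b
  ∏ₛ-one k F a b F≡1 n =
    ∏ₛ-extend {0} {k} F a b (≤⇒≤′ z≤n) (λ l m i j _ → F≡1 l m i j) n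

∏∞-limit : ∀ {F} → Admissible F → ∀ n a b {M N} → a < M → b < N →
  ∏ₛ M (λ i → ∏ₛ N (λ j → F i j)) n a b ≡ ∏∞ F n a b
∏∞-limit {F} adm n a b {M} {N} a<M b<N = begin
  ∏ₛ M (λ i → ∏ₛ N (F i)) n a b
    ≡⟨ ∏ₛ-extend (λ i → ∏ₛ N (F i)) a b (≤⇒≤′ a<M)
         (λ l m i j a<l i≤a _ → ∏ₛ-one N (F l) i j
           (λ l′ m′ i′ j′ i′≤i _ →
             adm l l′ m′ i′ j′ (inj₁ (≤-<-trans (≤-trans i′≤i i≤a) a<l))) m) n ⟩
  ∏ₛ (suc a) (λ i → ∏ₛ N (F i)) n a b
    ≡⟨ ∏ₛ-cong (suc a) a b
         (λ l m i j _ j≤b → ∏ₛ-extend (F l) i j (≤⇒≤′ b<N)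
           (λ l′ m′ i′ j′ b<l′ _ j′≤j →
             adm l l′ m′ i′ j′ (inj₂ (≤-<-trans (≤-trans j′≤j j≤b) b<l′))) m) n ⟩
  ∏∞ F n a b ∎
  where open ≡-Reasoning

factor-admissible : ∀ r p .{{_ : NonZero r}} .{{_ : NonZero p}} l →
  Admissible (factor r p l)
factor-admissible r p l i j n a b small with (i + j) % r ≡ᵇ (l * (r / p)) % r
... | false = refl
... | true  = geometric n a b small
  where
  geometric : ∀ n a b → a < i ⊎ b < j → 1/[1-uq₁^ i q₂^ j ] n a b ≡ 1ₛ n a b
  geometric zero zero    zero    _ = refl
  geometric zero zero    (suc b) _ = refl
  geometric zero (suc a) b       _ = refl
  geometric (suc n) a b (inj₁ a<i)
    rewrite dec-false (a ≟ suc n * i) (<⇒≢ (<-≤-trans a<i (m≤m+n i (n * i)))) = refl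
  geometric (suc n) a b (inj₂ b<j)
    rewrite dec-false (b ≟ suc n * j) (<⇒≢ (<-≤-trans b<j (m≤m+n j (n * j))))
          | ∧-zeroʳ (a ≡ᵇ suc n * i) = refl

------------------------------------------------------------------------
-- Monomials in x₁,…,xₙ,y₁,…,yₙ, as pairs of exponent vectors

Mon : ℕ → Set
Mon n = Vec ℕ n × Vec ℕ n

degˣ degʸ : ∀ {n} → Mon n → ℕ
degˣ (α , β) = Vec.sum α
degʸ (α , β) = Vec.sum β

_≟ₘ_ : ∀ {n} → DecidableEquality (Mon n)
_≟ₘ_ = Product.≡-dec (Vec.≡-dec _≟_) (Vec.≡-dec _≟_)

_∙ₘ_ : ∀ {n} → Mon n → Mon n → Mon n
(α , β) ∙ₘ (α′ , β′) = zipWith _+_ α α′ , zipWith _+_ β β′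

𝟎 : ∀ {n} → Vec ℕ n
𝟎 = replicate _ 0

𝐞 : ∀ {n} → Fin n → Vec ℕ n
𝐞 j = 𝟎 [ j ]≔ 1

------------------------------------------------------------------------
-- The library has no complex numbers, so the base field is an arbitrary
-- (Heyting) field K; for K = ℂ take ζ = exp(2πi/r) below.

module _ {c ℓ₁ ℓ₂ : Level} (K : HeytingField c ℓ₁ ℓ₂) where

  private
    commutativeRing : CommutativeRing c ℓ₁
    commutativeRing = HeytingCommutativeRing.commutativeRing
      (HeytingField.heytingCommutativeRing K)

    module R = CommutativeRing commutativeRing

  open HeytingField K using (Carrier; _≈_; _#_; 0#; 1#)
    renaming (_+_ to _+ᶠ_; _*_ to _*ᶠ_; -_ to -ᶠ_)
  open import Algebra.Properties.Semiring.Exp R.semiring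
    using (^-congʳ; ^-congˡ; ^-homo-*; ^-assocʳ) renaming (_^_ to _^ᶠ_)
  open import Algebra.Properties.Semiring.Mult R.semiring
    using () renaming (_×_ to _×ᶠ_)
  open import Algebra.Properties.Semiring.Sum R.semiring
    using () renaming (sum to Σᶠ)

  CharacteristicZero : Set ℓ₂
  CharacteristicZero = ∀ n → 0 < n → (n ×ᶠ 1#) # 0#

  record IsPrimitiveRoot (r : ℕ) (ζ : Carrier) : Set (c ⊔ ℓ₁ ⊔ ℓ₂) where
    field
      root  : ζ ^ᶠ r ≈ 1#
      apart : ∀ k → 0 < k → k < r → (ζ ^ᶠ k) # 1#

  ----------------------------------------------------------------------
  -- Groups

  Matrix : ℕ → Set c
  Matrix n = Fin n → Fin n → Carrier

  -- Laplace expansion along the first row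
  det : ∀ {n} → Matrix n → Carrier
  det {zero}  A = 1#
  det {suc n} A = Σᶠ λ j →
    ((-ᶠ 1#) ^ᶠ toℕ j) *ᶠ A zero j *ᶠ det (λ i k → A (suc i) (punchIn j k))

  -- A ∈ G(r,n); here r ≥ 1, so that r-th roots of unity are nonzero
  record InGrn (r n : ℕ) (A : Matrix n) : Set (c ⊔ ℓ₁ ⊔ ℓ₂) where
    field
      row : ∀ i → ∃[ j ] A i j ^ᶠ r ≈ 1# × (∀ j′ → j′ ≢ j → A i j′ ≈ 0#)
      col : ∀ j → ∃[ i ] A i j ^ᶠ r ≈ 1# × (∀ i′ → i′ ≢ i → A i′ j ≈ 0#)

    -- |A|: roots of unity have absolute value 1
    ∣A∣ : Matrix n
    ∣A∣ i j = if does (j Fin.≟ proj₁ (row i)) then 1# else 0#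

  -- A ∈ G(r,p,n); the ω of detRatio is det A / det |A|
  record InGrpn (r p n : ℕ) .{{_ : NonZero p}} (A : Matrix n)
         : Set (c ⊔ ℓ₁ ⊔ ℓ₂) where
    field
      inG : InGrn r n A
    open InGrn inG public
    field
      detRatio : ∃[ ω ] ω ^ᶠ (r / p) ≈ 1# × det A ≈ ω *ᶠ det ∣A∣

  module _ (r p s n : ℕ) .{{_ : NonZero p}} .{{_ : NonZero s}}
           (s∣r : s ∣ r) {ζ : Carrier} (ζ-prim : IsPrimitiveRoot r ζ) where

    -- For ζ = exp(2πi/r) this is exp(2πi/s), so C_s consists of the ω ^ k I
    private
      ω : Carrier
      ω = ζ ^ᶠ (r / s)

    CosetEq : Matrix n → Matrix n → Set ℓ₁
    CosetEq A B = ∃[ k ] ∀ i j → B i j ≈ (ω ^ᶠ k) *ᶠ A i j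

    private
      ω^s≈1 : ω ^ᶠ s ≈ 1#
      ω^s≈1 = R.trans (^-assocʳ ζ (r / s) s)
        (R.trans (^-congʳ ζ (m/n*n≡m s∣r)) (IsPrimitiveRoot.root ζ-prim))

      1^k≈1 : ∀ k → 1# ^ᶠ k ≈ 1#
      1^k≈1 zero    = R.refl
      1^k≈1 (suc k) = R.trans (R.*-identityˡ _) (1^k≈1 k)

      CosetEq-sym : ∀ {A B} → CosetEq A B → CosetEq B A
      CosetEq-sym {A} {B} (k , B≈ωᵏA) = pred s * k , λ i j → begin
        A i j                                   ≈⟨ R.*-identityˡ _ ⟨
        1# *ᶠ A i j                             ≈⟨ R.*-congʳ ω-inverse ⟨
        ω ^ᶠ (pred s * k) *ᶠ ω ^ᶠ k *ᶠ A i j    ≈⟨ R.*-assoc _ _ _ ⟩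
        ω ^ᶠ (pred s * k) *ᶠ (ω ^ᶠ k *ᶠ A i j)  ≈⟨ R.*-congˡ (B≈ωᵏA i j) ⟨
        ω ^ᶠ (pred s * k) *ᶠ B i j              ∎
        where
        open import Relation.Binary.Reasoning.Setoid R.setoid
        pred-s*k+k≡s*k : pred s * k + k ≡ s * k
        pred-s*k+k≡s*k = trans (+-comm (pred s * k) k) (cong (_* k) (suc-pred s))
        ω-inverse : ω ^ᶠ (pred s * k) *ᶠ ω ^ᶠ k ≈ 1#
        ω-inverse = begin
          ω ^ᶠ (pred s * k) *ᶠ ω ^ᶠ k  ≈⟨ ^-homo-* ω (pred s * k) k ⟨
          ω ^ᶠ (pred s * k + k)        ≈⟨ ^-congʳ ω pred-s*k+k≡s*k ⟩
          ω ^ᶠ (s * k)                 ≈⟨ ^-assocʳ ω s k ⟨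
          (ω ^ᶠ s) ^ᶠ k                ≈⟨ ^-congˡ k ω^s≈1 ⟩
          1# ^ᶠ k                      ≈⟨ 1^k≈1 k ⟩
          1#                           ∎

      CosetEq-trans : ∀ {A B C} → CosetEq A B → CosetEq B C → CosetEq A C
      CosetEq-trans {A} {B} {C} (k , B≈) (l , C≈) = l + k , λ i j → begin
        C i j                           ≈⟨ C≈ i j ⟩
        ω ^ᶠ l *ᶠ B i j                 ≈⟨ R.*-congˡ (B≈ i j) ⟩
        ω ^ᶠ l *ᶠ (ω ^ᶠ k *ᶠ A i j)     ≈⟨ R.*-assoc _ _ _ ⟨
        ω ^ᶠ l *ᶠ ω ^ᶠ k *ᶠ A i j       ≈⟨ R.*-congʳ (^-homo-* ω l k) ⟨
        ω ^ᶠ (l + k) *ᶠ A i j           ∎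
        where open import Relation.Binary.Reasoning.Setoid R.setoid

    -- G(r,p,s,n) = G(r,p,n) / C_s, whose elements are represented by matrices
    -- in G(r,p,n).  (C_s ⊆ G(r,p,n) when moreover p s ∣ r n.)
    QuotientG : Setoid (c ⊔ ℓ₁ ⊔ ℓ₂) ℓ₁
    QuotientG = record
      { Carrier       = Σ (Matrix n) (InGrpn r p n)
      ; _≈_           = λ g h → CosetEq (proj₁ g) (proj₁ h)
      ; isEquivalence = record
        { refl  = 0 , λ i j → R.sym (R.*-identityˡ _)
        ; sym   = CosetEq-sym
        ; trans = CosetEq-trans
        }
      }

  ----------------------------------------------------------------------
  -- K[x₁,…,xₙ,y₁,…,yₙ]: a polynomial is a formal list of terms, and two
  -- polynomials are equal when all their coefficients are.

  Poly : ℕ → Set c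
  Poly n = List (Carrier × Mon n)

  coeff : ∀ {n} → Poly n → Mon n → Carrier
  coeff []            m = 0#
  coeff ((a , μ) ∷ f) m = (if does (μ ≟ₘ m) then a else 0#) +ᶠ coeff f m

  infix  4 _≈ₚ_
  infixl 6 _+ₚ_
  infixl 7 _*ₚ_
  infixr 7 _•_

  _≈ₚ_ : ∀ {n} → Poly n → Poly n → Set ℓ₁
  f ≈ₚ g = ∀ m → coeff f m ≈ coeff g m

  0ₚ 1ₚ : ∀ {n} → Poly n
  0ₚ = []
  1ₚ = (1# , 𝟎 , 𝟎) ∷ []

  _+ₚ_ _*ₚ_ : ∀ {n} → Poly n → Poly n → Poly n
  _+ₚ_ = _++_
  _*ₚ_ = cartesianProductWith λ (a , μ) (b , ν) → a *ᶠ b , μ ∙ₘ ν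

  _•_ : ∀ {n} → Carrier → Poly n → Poly n
  a • f = List.map (λ (b , μ) → a *ᶠ b , μ) f

  _^ₚ_ : ∀ {n} → Poly n → ℕ → Poly n
  f ^ₚ zero  = 1ₚ
  f ^ₚ suc k = f *ₚ (f ^ₚ k)

  Σₚ ∏ₚ : ∀ {n k} → (Fin k → Poly n) → Poly n
  Σₚ = Vector.foldr _+ₚ_ 0ₚ
  ∏ₚ = Vector.foldr _*ₚ_ 1ₚ

  mono : ∀ {n} → Mon n → Poly n
  mono m = (1# , m) ∷ []

  x y : ∀ {n} → Fin n → Poly n
  x j = mono (𝐞 j , 𝟎)
  y j = mono (𝟎 , 𝐞 j)

  -- (A f)(x , y) = f (A x , A y).  (Other conventions for the action use A⁻¹
  -- or Aᵀ instead; over a whole group G(r,p,n) the invariants are the same.)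
  actMon : ∀ {n} → Matrix n → Mon n → Poly n
  actMon A (α , β) =
    ∏ₚ (λ i → (Σₚ λ j → A i j • x j) ^ₚ Vec.lookup α i) *ₚ
    ∏ₚ (λ i → (Σₚ λ j → A i j • y j) ^ₚ Vec.lookup β i)

  act : ∀ {n} → Matrix n → Poly n → Poly n
  act A = concatMap λ (a , μ) → a • actMon A μ

  -- The subalgebra S_s[X,Y]
  data S[X,Y] {n} (s : ℕ) : Poly n → Set (c ⊔ ℓ₁) where
    one   : S[X,Y] s 1ₚ
    gen   : ∀ m → s ∣ degˣ m → s ∣ degʸ m → S[X,Y] s (mono m)
    plus  : ∀ {f g} → S[X,Y] s f → S[X,Y] s g → S[X,Y] s (f +ₚ g)
    times : ∀ {f g} → S[X,Y] s f → S[X,Y] s g → S[X,Y] s (f *ₚ g)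
    scale : ∀ a {f} → S[X,Y] s f → S[X,Y] s (a • f)
    resp  : ∀ {f g} → f ≈ₚ g → S[X,Y] s f → S[X,Y] s g

  -- S_s[X,Y]^{ΔG(r,p,s,n)}; a class acts on S_s[X,Y] through any of its
  -- representatives, since C_s acts trivially there.
  Invariants : (r p s n : ℕ) .{{_ : NonZero p}} .{{_ : NonZero s}} →
    s ∣ r → ∀ {ζ} → IsPrimitiveRoot r ζ → Poly n → Set (c ⊔ ℓ₁ ⊔ ℓ₂)
  Invariants r p s n s∣r ζ-prim f =
    S[X,Y] s f ×
    (∀ (g : Setoid.Carrier (QuotientG r p s n s∣r ζ-prim)) → act (proj₁ g) f ≈ₚ f)

  ----------------------------------------------------------------------
  -- Hilbert series of subspaces of K[x₁,…,xₙ,y₁,…,yₙ]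

  record HasDimension {ℓ n} (V : Poly n → Set ℓ) (d : ℕ) : Set (c ⊔ ℓ₁ ⊔ ℓ) where
    field
      basis       : Fin d → Poly n
      inV         : ∀ i → V (basis i)
      independent : ∀ (k : Fin d → Carrier) →
                    Σₚ (λ i → k i • basis i) ≈ₚ 0ₚ → ∀ i → k i ≈ 0#
      spanning    : ∀ f → V f → Σ[ k ∈ (Fin d → Carrier) ] Σₚ (λ i → k i • basis i) ≈ₚ f

  Bidegree : ∀ {n} → ℕ → ℕ → Poly n → Set ℓ₁
  Bidegree a b f = ∀ m → ¬ (degˣ m ≡ a × degʸ m ≡ b) → coeff f m ≈ 0#

  -- Hilb(V)(q₁,q₂) = Σ_{a,b} (H a b) q₁ᵃ q₂ᵇ
  IsHilb : ∀ {ℓ n} → (Poly n → Set ℓ) → (ℕ → ℕ → ℕ) → Set (c ⊔ ℓ₁ ⊔ ℓ)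
  IsHilb V H = ∀ a b → HasDimension (λ f → V f × Bidegree a b f) (H a b)

{-# OPTIONS --safe #-}

-- A monomial x^α y^β is an eigenvector of the diagonal matrices of G(r,p,n); as n ≥ 1, it is
-- invariant under all of them iff the numbers αₜ + βₜ are all congruent to one and the same
-- l r/p modulo r, and l < p is then unique.  Hence the orbit sums of these monomials under the
-- symmetric group form a basis of the invariants.  Orbits are multisets of n pairs (αₜ , βₜ),
-- which are counted by ∏ 1 / (1 - u q₁ⁱ q₂ʲ) over i + j ≡ l r/p.  When d ∣ n, s divides n r/p,
-- so a multiset of bidegree (a , b) with s ∣ a has s ∣ b as well.

module Submission where

open import Defs
open import Algebra.Apartness.Bundles using (HeytingField; HeytingCommutativeRing)
open import Algebra.Bundles using (CommutativeRing; CommutativeMonoid)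
open import Data.Bool.Base using (true; false; if_then_else_)
open import Data.Bool.Properties using (if-∧)
open import Data.Empty using (⊥)
open import Data.Fin.Base using (Fin; zero; suc; toℕ; punchIn; punchOut; cast)
import Data.Fin.Permutation as Perm
open Perm using (Permutation′; _⟨$⟩ʳ_; _⟨$⟩ˡ_)
import Data.Fin.Properties as Fin
open import Data.List.Base as List
  using (List; []; _∷_; _++_; length; map; filter; replicate; upTo;
         cartesianProduct; cartesianProductWith)
open import Data.List.Membership.Propositional using (_∈_; _∉_)
open import Data.List.Membership.Propositional.Properties
  using (∈-filter⁺; ∈-filter⁻; ∈-cartesianProduct⁺; ∈-cartesianProductWith⁺; ∈-upTo⁺)
import Data.List.Properties as List
open import Data.List.Relation.Binary.Permutation.Propositional
  using (_↭_; ↭-sym; ↭-trans; ↭-reflexive)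
open import Data.List.Relation.Binary.Permutation.Propositional.Properties using (All-resp-↭)
open import Data.List.Relation.Unary.All as All using (All; []; _∷_)
import Data.List.Relation.Unary.All.Properties as All
open import Data.List.Relation.Unary.AllPairs using ([]; _∷_)
open import Data.List.Relation.Unary.Any using (here; there)
open import Data.List.Relation.Unary.Unique.Propositional using (Unique)
import Data.List.Relation.Unary.Unique.Propositional.Properties as Unique
open import Data.Nat.Base as ℕ using (ℕ; zero; suc; NonZero; pred; _≤_; _<_; z≤n; s≤s; s≤s⁻¹)
open import Data.Nat.Divisibility
open import Data.Nat.DivMod
import Data.Nat.Properties as ℕ
open import Data.Product.Base using (Σ; Σ-syntax; ∃-syntax; _×_; _,_; proj₁; proj₂)
open import Data.Sum.Base using (_⊎_; inj₁; inj₂; [_,_]′)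
open import Data.Vec.Base as Vec using (Vec; lookup; tabulate; zipWith)
import Data.Vec.Functional as Vector
import Data.Vec.Properties as Vec
open import Function.Base using (_∘_; id)
open import Function.Bundles using (_↔_; Inverse)
open import Function.Definitions using (Injective)
open import Level using (Level; _⊔_)
open import Relation.Binary.PropositionalEquality as ≡
  using (_≡_; _≢_; refl; cong; cong₂; subst)
open import Relation.Nullary using (¬_; Dec; yes; no; does; ¬?; _×-dec_; contradiction)
open import Relation.Nullary.Decidable using (map′)
open import Relation.Unary using (Decidable)

-- Over a Heyting field, equality of a coefficient with 0 is in general not decidable. All case
-- distinctions are therefore made on exponents, and a coefficient is shown to vanish by a diagonal
-- matrix whose eigenvalue `ζ ^ k` is apart from 1, so that `ζ ^ k - 1` can be inverted. A basis has
-- to be indexed by `Fin D` with `D` the literal coefficient of the series. That coefficient is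
-- never computed: each operation on series is matched by a construction on multisets (sums by
-- disjoint unions, products by concatenations) which delivers the index set `Fin (F n a b)`.
-- Concatenation becomes a bijection on classes once the cells of the two factors can be told apart,
-- hence the decidable, disjoint sets of cells that accompany the counting. A polynomial is a list
-- that may repeat monomials, so it is tested against linear functionals instead of being compared
-- term by term.

module _ where

  open Perm using (_∘ₚ_)
  open import Data.List.Properties
    using (filter-++; filter-all; filter-none; ++-identityʳ; length-++; map-++)
  import Data.List.Relation.Binary.Permutation.Homogeneous as ↭ₛ using (onIndices)
  open import Data.List.Relation.Binary.Permutation.Propositional
    using (refl; prep; swap; trans; ↭⇒↭ₛ)
  open import Data.List.Relation.Binary.Permutation.Propositional.Properties
    using (filter-↭; ↭-length; ++⁺; shift) renaming (map⁺ to ↭-map⁺)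
  import Data.List.Relation.Binary.Permutation.Setoid.Properties as ↭ₛ using (onIndices-lookup)
  open import Data.Nat.Base using (_+_; _*_; _∸_; ≢-nonZero; ≢-nonZero⁻¹)
  open import Data.Nat.GCD using (gcd; gcd[m,n]∣m; gcd[m,n]∣n; gcd[m,n]≢0)
  open import Data.Nat.ListAction using (sum)
  open import Data.Nat.ListAction.Properties using (sum-++; sum-↭)
  open import Data.Nat.Properties
  open import Data.Product.Properties using (≡-dec)
  open import Function.Properties.Inverse using (↔-sym)

  -- Counting multisets by generating functions

  -- A finite multiset is a list up to ↭.  The representatives of those which
  -- satisfy P are indexed by I.
  record Classes {A : Set} (P : List A → Set) (I : Set) : Set where
    field
      rep      : I → List A
      rep∈     : ∀ i → P (rep i)
      distinct : ∀ i j → rep i ↭ rep j → i ≡ j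
      index    : ∀ {xs} → P xs → ∃[ i ] xs ↭ rep i

  module _ {A : Set} where

    reindex : ∀ {P : List A → Set} {I J} → I ↔ J → Classes P I → Classes P J
    reindex {P} {I} {J} I↔J C = record
      { rep      = C.rep ∘ from
      ; rep∈     = C.rep∈ ∘ from
      ; distinct = λ i j eq → begin
          i            ≡⟨ Inverse.strictlyInverseˡ I↔J i ⟨
          to (from i)  ≡⟨ cong to (C.distinct _ _ eq) ⟩
          to (from j)  ≡⟨ Inverse.strictlyInverseˡ I↔J j ⟩
          j            ∎
      ; index    = λ {xs} p → let i , xs↭ = C.index p in
          to i , subst (λ k → xs ↭ C.rep k) (≡.sym (Inverse.strictlyInverseʳ I↔J i)) xs↭
      }
      where
      module C = Classes C
      open Inverse I↔J using (to; from)
      open ≡.≡-Reasoning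

    Classes-resp : ∀ {P Q : List A → Set} {I} →
      (∀ {xs} → P xs → Q xs) → (∀ {xs} → Q xs → P xs) → Classes P I → Classes Q I
    Classes-resp P⇒Q Q⇒P C = record
      { rep = C.rep ; rep∈ = P⇒Q ∘ C.rep∈ ; distinct = C.distinct ; index = C.index ∘ Q⇒P }
      where module C = Classes C

    Classes-∅ : ∀ {P : List A → Set} → (∀ {xs} → ¬ P xs) → Classes P (Fin 0)
    Classes-∅ ¬P = record
      { rep = λ () ; rep∈ = λ () ; distinct = λ () ; index = λ p → contradiction p ¬P }

    Classes-singleton : ∀ {P : List A → Set} xs → P xs → (∀ {ys} → P ys → ys ≡ xs) →
      Classes P (Fin 1)
    Classes-singleton xs p unique = record
      { rep      = λ _ → xs
      ; rep∈     = λ _ → p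
      ; distinct = λ { Fin.zero Fin.zero _ → refl }
      ; index    = λ q → Fin.zero , ↭-reflexive (unique q)
      }

    Classes-⊎ : ∀ {P Q : List A → Set} {I J} → (∀ {xs ys} → P xs → Q ys → ¬ (xs ↭ ys)) →
      Classes P I → Classes Q J → Classes (λ xs → P xs ⊎ Q xs) (I ⊎ J)
    Classes-⊎ disjoint C D = record
      { rep      = [ C.rep , D.rep ]′
      ; rep∈     = λ { (inj₁ i) → inj₁ (C.rep∈ i) ; (inj₂ j) → inj₂ (D.rep∈ j) }
      ; distinct = λ
          { (inj₁ i) (inj₁ i′) eq → cong inj₁ (C.distinct i i′ eq)
          ; (inj₁ i) (inj₂ j)  eq → contradiction eq (disjoint (C.rep∈ i) (D.rep∈ j))
          ; (inj₂ j) (inj₁ i)  eq → contradiction (↭-sym eq) (disjoint (C.rep∈ i) (D.rep∈ j))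
          ; (inj₂ j) (inj₂ j′) eq → cong inj₂ (D.distinct j j′ eq)
          }
      ; index    = λ
          { (inj₁ p) → let i , eq = C.index p in inj₁ i , eq
          ; (inj₂ q) → let j , eq = D.index q in inj₂ j , eq
          }
      }
      where
      module C = Classes C
      module D = Classes D

    -- The second hypothesis says that the class of a multiset determines its summand; this makes
    -- the union over `i` disjoint.
    Classes-Σ< : (P : ℕ → List A → Set) {f : ℕ → ℕ} →
      (∀ {i j xs ys} → P i xs → P j ys → xs ↭ ys → i ≡ j) →
      ∀ k → (∀ i → i < k → Classes (P i) (Fin (f i))) →
      Classes (λ xs → ∃[ i ] i < k × P i xs) (Fin (Σ< k f))
    Classes-Σ< P tag zero    C = Classes-∅ λ ()
    Classes-Σ< P tag (suc k) C =
      Classes-resp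
        (λ { (inj₁ p) → k , ≤-refl , p ; (inj₂ (i , i<k , p)) → i , m<n⇒m<1+n i<k , p })
        split
        -- `applyDownFrom` puts the largest index first, so `Σ< (suc k) f` unfolds to
        -- `f k + Σ< k f`.
        (reindex (↔-sym Fin.+↔⊎)
          (Classes-⊎ (λ { p (i , i<k , q) eq → <⇒≢ i<k (≡.sym (tag p q eq)) })
            (C k ≤-refl)
            (Classes-Σ< P tag k λ i i<k → C i (m<n⇒m<1+n i<k))))
      where
      split : ∀ {xs} → ∃[ i ] i < suc k × P i xs → P k xs ⊎ ∃[ i ] i < k × P i xs
      split (i , i<1+k , p) with m≤n⇒m<n∨m≡n (s≤s⁻¹ i<1+k)
      ... | inj₁ i<k  = inj₂ (i , i<k , p)
      ... | inj₂ refl = inj₁ p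

    filter-++-disjoint : ∀ {U W : A → Set} (U? : Decidable U) → (∀ {c} → W c → ¬ U c) →
      ∀ {ys zs} → All U ys → All W zs → filter U? (ys ++ zs) ≡ ys
    filter-++-disjoint U? disjoint {ys} {zs} Uys Wzs = begin
      filter U? (ys ++ zs)            ≡⟨ filter-++ U? ys zs ⟩
      filter U? ys ++ filter U? zs
        ≡⟨ cong₂ _++_ (filter-all U? Uys) (filter-none U? (All.map disjoint Wzs)) ⟩
      ys ++ []                        ≡⟨ ++-identityʳ ys ⟩
      ys                              ∎
      where open ≡.≡-Reasoning

    filter-∁-++-disjoint : ∀ {U W : A → Set} (U? : Decidable U) → (∀ {c} → W c → ¬ U c) →
      ∀ {ys zs} → All U ys → All W zs → filter (¬? ∘ U?) (ys ++ zs) ≡ zs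
    filter-∁-++-disjoint U? disjoint {ys} {zs} Uys Wzs = begin
      filter (¬? ∘ U?) (ys ++ zs)                    ≡⟨ filter-++ (¬? ∘ U?) ys zs ⟩
      filter (¬? ∘ U?) ys ++ filter (¬? ∘ U?) zs
        ≡⟨ cong₂ _++_ (filter-none (¬? ∘ U?) (All.map (λ u ¬u → ¬u u) Uys))
                      (filter-all (¬? ∘ U?) (All.map disjoint Wzs)) ⟩
      zs                                             ∎
      where open ≡.≡-Reasoning

    filter-partition : ∀ {U : A → Set} (U? : Decidable U) xs →
      xs ↭ filter U? xs ++ filter (¬? ∘ U?) xs
    filter-partition U? []       = refl
    filter-partition U? (x ∷ xs) with does (U? x)
    ... | true  = prep x (filter-partition U? xs)
    ... | false = trans (prep x (filter-partition U? xs)) (↭-sym (shift x (filter U? xs) _))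

    -- Filtering by `U?` and by its complement recovers the two parts and respects `↭`, so the class
    -- of a concatenation determines the classes of its parts.
    Classes-++ : ∀ {P Q : List A → Set} {U W : A → Set} {I J} →
      Decidable U → (∀ {c} → W c → ¬ U c) →
      (∀ {xs} → P xs → All U xs) → (∀ {xs} → Q xs → All W xs) →
      Classes P I → Classes Q J →
      Classes (λ xs → ∃[ ys ] ∃[ zs ] xs ↭ ys ++ zs × P ys × Q zs) (I × J)
    Classes-++ U? disjoint P⇒U Q⇒W C D = record
      { rep      = λ (i , j) → C.rep i ++ D.rep j
      ; rep∈     = λ (i , j) → C.rep i , D.rep j , refl , C.rep∈ i , D.rep∈ j
      ; distinct = λ (i , j) (i′ , j′) eq → cong₂ _,_
          (C.distinct i i′ (≡.subst₂ _↭_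
            (filter-++-disjoint U? disjoint (U i) (W j))
            (filter-++-disjoint U? disjoint (U i′) (W j′)) (filter-↭ U? eq)))
          (D.distinct j j′ (≡.subst₂ _↭_
            (filter-∁-++-disjoint U? disjoint (U i) (W j))
            (filter-∁-++-disjoint U? disjoint (U i′) (W j′)) (filter-↭ (¬? ∘ U?) eq)))
      ; index    = λ (ys , zs , eq , p , q) →
          let i , ys↭ = C.index p
              j , zs↭ = D.index q
          in (i , j) , ↭-trans eq (++⁺ ys↭ zs↭)
      }
      where
      module C = Classes C
      module D = Classes D
      U = λ i → P⇒U (C.rep∈ i)
      W = λ j → Q⇒W (D.rep∈ j)

  Cell : Set
  Cell = ℕ × ℕ

  record Weight (n a b : ℕ) (xs : List Cell) : Set where
    constructor weight
    field
      length≡ : length xs ≡ n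
      sum₁≡   : sum (map proj₁ xs) ≡ a
      sum₂≡   : sum (map proj₂ xs) ≡ b

  Weight-↭ : ∀ {n a b xs ys} → xs ↭ ys → Weight n a b xs → Weight n a b ys
  Weight-↭ xs↭ys (weight refl refl refl) = weight
    (↭-length (↭-sym xs↭ys))
    (sum-↭ (↭-map⁺ proj₁ (↭-sym xs↭ys))) (sum-↭ (↭-map⁺ proj₂ (↭-sym xs↭ys)))

  Weight-++ : ∀ {n a b n′ a′ b′ xs ys} → Weight n a b xs → Weight n′ a′ b′ ys →
    Weight (n + n′) (a + a′) (b + b′) (xs ++ ys)
  Weight-++ {xs = xs} {ys} (weight refl refl refl) (weight refl refl refl) =
    weight (length-++ xs) (sum-map-++ proj₁) (sum-map-++ proj₂)
    where
    sum-map-++ : ∀ (f : Cell → ℕ) → sum (map f (xs ++ ys)) ≡ sum (map f xs) + sum (map f ys)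
    sum-map-++ f = ≡.trans (cong sum (map-++ f xs ys)) (sum-++ (map f xs) (map f ys))

  Weight? : ∀ n a b → Decidable (Weight n a b)
  Weight? n a b xs = map′ (λ (p , q , r) → weight p q r) (λ { (weight p q r) → p , q , r })
    ((length xs ≟ n) ×-dec ((sum (map proj₁ xs) ≟ a) ×-dec (sum (map proj₂ xs) ≟ b)))

  -- F is the generating function of the multisets of cells lying in U.
  Counts : (Cell → Set) → FPS → Set
  Counts U F = ∀ n a b → Classes (λ xs → All U xs × Weight n a b xs) (Fin (F n a b))

  Counts-resp : ∀ {U W : Cell → Set} {F} → (∀ {c} → U c → W c) → (∀ {c} → W c → U c) →
    Counts U F → Counts W F
  Counts-resp U⇒W W⇒U C n a b =
    Classes-resp (λ (u , w) → All.map U⇒W u , w) (λ (u , w) → All.map W⇒U u , w) (C n a b)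

  Counts-1ₛ : Counts (λ _ → ⊥) 1ₛ
  Counts-1ₛ zero zero zero =
    Classes-singleton [] ([] , weight refl refl refl) λ { ([] , _) → refl }
  Counts-1ₛ zero    zero    (suc b) = Classes-∅ λ { ([] , weight _ _ ()) }
  Counts-1ₛ zero    (suc a) b       = Classes-∅ λ { ([] , weight _ () _) }
  Counts-1ₛ (suc n) a       b       = Classes-∅ λ { ([] , weight () _ _) }

  module _ (i j : ℕ) where

    All≡⇒replicate : ∀ {xs : List Cell} → All (_≡ (i , j)) xs → xs ≡ replicate (length xs) (i , j)
    All≡⇒replicate []          = refl
    All≡⇒replicate (refl ∷ eq) = cong (_ ∷_) (All≡⇒replicate eq)

    Weight-replicate : ∀ n → Weight n (n * i) (n * j) (replicate n (i , j))
    Weight-replicate zero    = weight refl refl refl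
    Weight-replicate (suc n) = let weight p q r = Weight-replicate n in
      weight (cong suc p) (cong (i +_) q) (cong (j +_) r)

    -- With a single kind of cell, the only multiset of size `n` is `n` copies of it, and its weight
    -- is forced.
    Counts-geometric : Counts (_≡ (i , j)) 1/[1-uq₁^ i q₂^ j ]
    Counts-geometric n a b = if-classes ((a ≟ n * i) ×-dec (b ≟ n * j))
      where
      if-classes : (d : Dec (a ≡ n * i × b ≡ n * j)) →
        Classes (λ xs → All (_≡ (i , j)) xs × Weight n a b xs) (Fin (if does d then 1 else 0))
      if-classes (yes (refl , refl)) = Classes-singleton (replicate n (i , j))
        (All.replicate⁺ n refl , Weight-replicate n)
        (λ { (eq , weight refl _ _) → All≡⇒replicate eq })
      if-classes (no ¬eq) = Classes-∅ λ { {xs} (eq , weight refl p q) →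
        let weight _ p′ q′ = Weight-replicate (length xs)
            xs≡         = All≡⇒replicate eq in
        ¬eq ( ≡.trans (≡.sym p) (≡.trans (cong (sum ∘ map proj₁) xs≡) p′)
            , ≡.trans (≡.sym q) (≡.trans (cong (sum ∘ map proj₂) xs≡) q′)) }

  -- The three nested sums of the Cauchy product run over the weight `(i , j , k)` of the part lying
  -- in `U`. That weight depends only on the class of the whole multiset, because the part is a
  -- filter of it.
  Counts-*ₛ : ∀ {U W : Cell → Set} {F G} → Decidable U → (∀ {c} → W c → ¬ U c) →
    Counts U F → Counts W G → Counts (λ c → U c ⊎ W c) (F *ₛ G)
  Counts-*ₛ {U} {W} {F} {G} U? disjoint C D n a b =
    Classes-resp
      (λ (i , i≤ , j , j≤ , k , k≤ , ys , zs , eq , (u , wt) , (w , wt′)) →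
        All-resp-↭ (↭-sym eq) (All.++⁺ (All.map inj₁ u) (All.map inj₂ w)) ,
        Weight-↭ (↭-sym eq)
          (subst₃ (m+[n∸m]≡n (s≤s⁻¹ i≤)) (m+[n∸m]≡n (s≤s⁻¹ j≤)) (m+[n∸m]≡n (s≤s⁻¹ k≤))
            (Weight-++ wt wt′)))
      decompose
      (Classes-Σ< (λ i xs → ∃[ j ] j < suc a × ∃[ k ] k < suc b × Piece i j k xs)
         (λ (_ , _ , _ , _ , p) (_ , _ , _ , _ , q) eq → proj₁ (weights p q eq)) (suc n) λ i _ →
       Classes-Σ< (λ j xs → ∃[ k ] k < suc b × Piece i j k xs)
         (λ (_ , _ , p) (_ , _ , q) eq → proj₁ (proj₂ (weights p q eq))) (suc a) λ j _ →
       Classes-Σ< (Piece i j) (λ p q eq → proj₂ (proj₂ (weights p q eq))) (suc b) λ k _ →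
        reindex (↔-sym Fin.*↔×)
          (Classes-++ U? disjoint proj₁ proj₁ (C i j k) (D (n ∸ i) (a ∸ j) (b ∸ k))))
    where
    Piece : ℕ → ℕ → ℕ → List Cell → Set
    Piece i j k xs = ∃[ ys ] ∃[ zs ] xs ↭ ys ++ zs ×
      (All U ys × Weight i j k ys) × (All W zs × Weight (n ∸ i) (a ∸ j) (b ∸ k) zs)

    subst₃ : ∀ {n n′ a a′ b b′ xs} → n ≡ n′ → a ≡ a′ → b ≡ b′ → Weight n a b xs → Weight n′ a′ b′ xs
    subst₃ refl refl refl w = w

    weights : ∀ {i j k i′ j′ k′ xs xs′} → Piece i j k xs → Piece i′ j′ k′ xs′ → xs ↭ xs′ →
      i ≡ i′ × j ≡ j′ × k ≡ k′
    weights (ys , zs , eq , (u , wt) , w , _)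
      (ys′ , zs′ , eq′ , (u′ , weight refl refl refl) , w′ , _) xs↭
      with weight p q r ← Weight-↭ (≡.subst₂ _↭_
             (filter-++-disjoint U? disjoint u w) (filter-++-disjoint U? disjoint u′ w′)
             (filter-↭ U? (↭-trans (↭-sym eq) (↭-trans xs↭ eq′)))) wt
      = ≡.sym p , ≡.sym q , ≡.sym r

    only-W : ∀ {c} → U c ⊎ W c → ¬ U c → W c
    only-W (inj₁ u) ¬u = contradiction u ¬u
    only-W (inj₂ w) _  = w

    decompose : ∀ {xs} → All (λ c → U c ⊎ W c) xs × Weight n a b xs → _
    decompose {xs} (uw , weight refl refl refl)
      with weight p q r ← Weight-↭ {xs = filter U? xs ++ filter (¬? ∘ U?) xs} {ys = xs}
             (↭-sym (filter-partition U? xs))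
             (Weight-++ {xs = filter U? xs} (weight refl refl refl) (weight refl refl refl)) =
      _ , s≤s (≤-trans (m≤m+n _ _) (≤-reflexive (≡.sym p))) ,
      _ , s≤s (≤-trans (m≤m+n _ _) (≤-reflexive (≡.sym q))) ,
      _ , s≤s (≤-trans (m≤m+n _ _) (≤-reflexive (≡.sym r))) ,
      filter U? xs , filter (¬? ∘ U?) xs , filter-partition U? xs ,
      (All.all-filter U? xs , weight refl refl refl) ,
      All.zipWith (λ (uw , ¬u) → only-W uw ¬u)
        (All.filter⁺ (¬? ∘ U?) uw , All.all-filter (¬? ∘ U?) xs) ,
      weight (rest p) (rest q) (rest r)
      where
      rest : ∀ {m k l} → m ≡ k + l → l ≡ m ∸ k
      rest {_} {k} {l} refl = ≡.sym (m+n∸m≡n k l)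

  -- The tag names the only factor to which a cell can belong. It makes the factors disjoint and
  -- lets `U (tag c) c` replace an existential over `l`.
  Counts-∏ₛ : ∀ {U : ℕ → Cell → Set} {F} (tag : Cell → ℕ) → (∀ l → Decidable (U l)) →
    (∀ {l c} → U l c → tag c ≡ l) → (∀ l → Counts (U l) (F l)) →
    ∀ k → Counts (λ c → tag c < k × U (tag c) c) (∏ₛ k F)
  Counts-∏ₛ tag U? U⇒tag C zero    = Counts-resp (λ ()) (λ ()) Counts-1ₛ
  Counts-∏ₛ {U} tag U? U⇒tag C (suc k) = Counts-resp to from
    (Counts-*ₛ (U? k) (λ (tag<k , _) u → <⇒≢ tag<k (U⇒tag u)) (C k) (Counts-∏ₛ tag U? U⇒tag C k))
    where
    to : ∀ {c} → U k c ⊎ (tag c < k × U (tag c) c) → tag c < suc k × U (tag c) c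
    to {c} (inj₁ u) = ≤-reflexive (cong suc (U⇒tag u)) , subst (λ l → U l c) (≡.sym (U⇒tag u)) u
    to (inj₂ (lt , u)) = m<n⇒m<1+n lt , u
    from : ∀ {c} → tag c < suc k × U (tag c) c → U k c ⊎ (tag c < k × U (tag c) c)
    from {c} (lt , u) with m≤n⇒m<n∨m≡n (s≤s⁻¹ lt)
    ... | inj₁ lt′ = inj₂ (lt′ , u)
    ... | inj₂ eq  = inj₁ (subst (λ l → U l c) eq u)

  -- The products over residue classes as counts of multisets

  module _ (r p : ℕ) .{{_ : NonZero r}} .{{_ : NonZero p}} where

    Residue : ℕ → Cell → Set
    Residue l (i , j) = (i + j) % r ≡ (l * (r / p)) % r

    Counts-factor : ∀ l i j → Counts (λ c → c ≡ (i , j) × Residue l c) (factor r p l i j)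
    Counts-factor l i j = if-counts ((i + j) % r ≟ (l * (r / p)) % r)
      where
      if-counts : (d : Dec (Residue l (i , j))) →
        Counts (λ c → c ≡ (i , j) × Residue l c) (if does d then 1/[1-uq₁^ i q₂^ j ] else 1ₛ)
      if-counts (yes eq) = Counts-resp (λ { refl → refl , eq }) proj₁ (Counts-geometric i j)
      if-counts (no ¬eq) = Counts-resp (λ ()) (λ { (refl , eq) → ¬eq eq }) Counts-1ₛ

    Residue? : ∀ l → Decidable (Residue l)
    Residue? l (i , j) = (i + j) % r ≟ (l * (r / p)) % r

    bounded : ∀ (f : Cell → ℕ) {xs k} → sum (map f xs) ≤ k → All (λ c → f c < suc k) xs
    bounded f {[]}     _  = []
    bounded f {x ∷ xs} le =
      s≤s (≤-trans (m≤m+n (f x) _) le) ∷ bounded f (≤-trans (m≤n+m _ (f x)) le)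

    -- The partial product over `i ≤ a`, `j ≤ b` loses nothing: no cell of a multiset exceeds its
    -- totals (`bounded`). The double product is read off with the first coordinate as outer tag and
    -- the second as inner tag.
    Classes-∏∞ : ∀ l n a b →
      Classes (λ xs → All (Residue l) xs × Weight n a b xs) (Fin (∏∞ (factor r p l) n a b))
    Classes-∏∞ l n a b = Classes-resp
      (λ (u , w) → All.map (λ (_ , _ , _ , res) → res) u , w)
      (λ { {xs} (res , w@(weight refl refl refl)) →
        All.zipWith (λ (lt , lt′ , res) → lt , refl , lt′ , res)
          (bounded proj₁ ≤-refl , All.zip (bounded proj₂ ≤-refl , res)) , w })
      (Counts-∏ₛ {U = λ i c → proj₁ c ≡ i × proj₂ c < suc b × Residue l c} proj₁
        (λ i c → (proj₁ c ≟ i) ×-dec ((proj₂ c <? suc b) ×-dec Residue? l c))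
        proj₁
        (λ i → Counts-resp
          (λ { (lt , eq , res) → cong proj₁ eq , lt , res }) (λ { (refl , lt , res) → lt , refl , res })
          (Counts-∏ₛ proj₂ (λ j c → (≡-dec _≟_ _≟_ c (i , j)) ×-dec Residue? l c)
            (λ { (refl , _) → refl }) (Counts-factor l i) (suc b)))
        (suc a) n a b)

    Classes-Σₛ∏∞ : (∀ {l l′} → l < p → l′ < p → (l * (r / p)) % r ≡ (l′ * (r / p)) % r → l ≡ l′) →
      ∀ n → 1 ≤ n → ∀ a b →
      Classes (λ xs → (∃[ l ] l < p × All (Residue l) xs) × Weight n a b xs)
              (Fin (Σₛ p (λ l → ∏∞ (factor r p l)) n a b))
    Classes-Σₛ∏∞ inj n 1≤n a b = Classes-resp
      (λ { (l , l<p , _ , res , w) → (l , l<p , res) , w })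
      (λ { ((l , l<p , res) , w) → l , l<p , l<p , res , w })
      (Classes-Σ< (λ l xs → l < p × All (Residue l) xs × Weight n a b xs)
        -- The empty multiset satisfies `Residue l` for every `l`. A nonempty one is tagged by the
        -- residue of its first cell.
        (λ { {xs = []}     (_ , _ , weight refl _ _) _ _ → contradiction 1≤n λ ()
           ; {xs = _ ∷ _} (l<p , res ∷ _ , _) (l′<p , res′ , _) eq →
               inj l<p l′<p (≡.trans (≡.sym res)
                 (All.lookup (All-resp-↭ (↭-sym eq) res′) (here refl))) })
        p λ l l<p → Classes-resp (l<p ,_) proj₂ (Classes-∏∞ l n a b))

  -- Monomials as lists of exponent pairs, up to permutation

  module _ {A : Set} where

    tabulate-extract : ∀ {n} (w : Fin (suc n) → A) j →
      List.tabulate w ↭ w j ∷ List.tabulate (w ∘ punchIn j)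
    tabulate-extract w zero = refl
    tabulate-extract {suc n} w (suc j) =
      trans (prep (w zero) (tabulate-extract (w ∘ suc) j)) (swap _ _ refl)

    -- Induction on `n`: the entry at `π ⟨$⟩ʳ zero` is pulled to the front, and `Perm.remove` gives
    -- the permutation of the remaining entries.
    tabulate-permute : ∀ {n} (w : Fin n → A) (π : Permutation′ n) →
      List.tabulate (w ∘ (π ⟨$⟩ʳ_)) ↭ List.tabulate w
    tabulate-permute {zero}  w π = refl
    tabulate-permute {suc n} w π = ↭-sym (trans (tabulate-extract w (π ⟨$⟩ʳ zero)) (prep _ (↭-sym (trans
      (↭-reflexive (List.tabulate-cong λ i → cong w (Perm.punchIn-permute π zero i)))
      (tabulate-permute (w ∘ punchIn (π ⟨$⟩ʳ zero)) (Perm.remove zero π))))))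

    -- A derivation of `↭` carries a bijection of positions, `onIndices`. The casts are there
    -- because `length (tabulate u)` equals `n` only propositionally.
    ↭-tabulate⇒permutation : ∀ {n} (u w : Fin n → A) → List.tabulate u ↭ List.tabulate w →
      Σ[ π ∈ Permutation′ n ] ∀ i → u i ≡ w (π ⟨$⟩ʳ i)
    ↭-tabulate⇒permutation {n} u w u↭w =
      (Perm.cast-id (≡.sym ∣u∣≡n) ∘ₚ ↭ₛ.onIndices u↭ₛw ∘ₚ Perm.cast-id ∣w∣≡n) , λ i → begin
        u i                                          ≡⟨ List.lookup-tabulate u i ⟨
        List.lookup (List.tabulate u) (cast _ i)     ≡⟨ ↭ₛ.onIndices-lookup setoid u↭ₛw (cast _ i) ⟩
        List.lookup (List.tabulate w) (index i)      ≡⟨ lookup-tabulate′ (index i) ⟩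
        w (cast ∣w∣≡n (index i))                     ∎
      where
      open ≡.≡-Reasoning
      setoid = ≡.setoid A
      u↭ₛw = ↭⇒↭ₛ u↭w
      ∣u∣≡n = List.length-tabulate u
      ∣w∣≡n = List.length-tabulate w
      index = λ i → ↭ₛ.onIndices u↭ₛw ⟨$⟩ʳ cast (≡.sym ∣u∣≡n) i
      lookup-tabulate′ : ∀ k → List.lookup (List.tabulate w) k ≡ w (cast ∣w∣≡n k)
      lookup-tabulate′ k = ≡.trans
        (cong (List.lookup (List.tabulate w)) (≡.sym (Fin.cast-involutive (≡.sym ∣w∣≡n) ∣w∣≡n k)))
        (List.lookup-tabulate w (cast ∣w∣≡n k))

  cell : ∀ {n} → Mon n → Fin n → Cell
  cell (α , β) t = lookup α t , lookup β t

  -- Two monomials lie in the same orbit of the symmetric group iff their lists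
  -- of exponent pairs are permutations of each other.
  cells : ∀ {n} → Mon n → List Cell
  cells m = List.tabulate (cell m)

  sum-tabulate-lookup : ∀ {n} (α : Vec ℕ n) → sum (List.tabulate (lookup α)) ≡ Vec.sum α
  sum-tabulate-lookup Vec.[]      = refl
  sum-tabulate-lookup (a Vec.∷ α) = cong (a +_) (sum-tabulate-lookup α)

  Weight-cells : ∀ {n} (m : Mon n) → Weight n (degˣ m) (degʸ m) (cells m)
  Weight-cells m@(α , β) = weight (List.length-tabulate (cell m))
    (≡.trans (cong sum (List.map-tabulate (cell m) proj₁)) (sum-tabulate-lookup α))
    (≡.trans (cong sum (List.map-tabulate (cell m) proj₂)) (sum-tabulate-lookup β))

  Weight⇒bidegree : ∀ {n k a b} (m : Mon n) → Weight k a b (cells m) → degˣ m ≡ a × degʸ m ≡ b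
  Weight⇒bidegree m (weight _ refl refl) with weight _ p q ← Weight-cells m = ≡.sym p , ≡.sym q

  bidegree⇒Weight : ∀ {n a b} (m : Mon n) → degˣ m ≡ a → degʸ m ≡ b → Weight n a b (cells m)
  bidegree⇒Weight m refl refl = Weight-cells m

  cells-surjective : ∀ {n} xs → length xs ≡ n → Σ[ m ∈ Mon n ] cells m ≡ xs
  cells-surjective xs refl =
    (tabulate (proj₁ ∘ List.lookup xs) , tabulate (proj₂ ∘ List.lookup xs)) ,
    ≡.trans
      (List.tabulate-cong λ t → cong₂ _,_ (Vec.lookup∘tabulate _ t) (Vec.lookup∘tabulate _ t))
      (List.tabulate-lookup xs)

  -- Arithmetic modulo r

  module _ {r p : ℕ} .{{_ : NonZero r}} .{{_ : NonZero p}} (p∣r : p ∣ r) where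

    private
      q = r / p

      p*q≡r : p * q ≡ r
      p*q≡r = ≡.trans (*-comm p q) (m/n*n≡m p∣r)

      instance
        q≢0 : NonZero q
        q≢0 = m*n≢0⇒n≢0 p {{subst NonZero (≡.sym p*q≡r) (≢-nonZero (≢-nonZero⁻¹ r))}}

      l*q<r : ∀ {l} → l < p → l * q < r
      l*q<r {l} l<p = subst (l * q <_) p*q≡r (*-monoˡ-< q l<p)

    residue-injective : ∀ {l l′} → l < p → l′ < p → (l * q) % r ≡ (l′ * q) % r → l ≡ l′
    residue-injective {l} {l′} l<p l′<p eq = *-cancelʳ-≡ l l′ q (begin
      l * q         ≡⟨ m<n⇒m%n≡m (l*q<r l<p) ⟨
      (l * q) % r   ≡⟨ eq ⟩
      (l′ * q) % r  ≡⟨ m<n⇒m%n≡m (l*q<r l′<p) ⟩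
      l′ * q        ∎)
      where open ≡.≡-Reasoning

    -- Since `r = p * q`, cancelling `p` gives `q ∣ k`, hence `q ∣ k % r`. The witness is the
    -- quotient, and `k % r < p * q` bounds it by `p`.
    residue-exists : ∀ k → r ∣ p * k → ∃[ l ] l < p × k % r ≡ (l * q) % r
    residue-exists k r∣pk = _∣_.quotient q∣k%r , l<p , (begin
      k % r        ≡⟨ m%n%n≡m%n k r ⟨
      k % r % r    ≡⟨ cong (_% r) (_∣_.equality q∣k%r) ⟩
      _            ∎)
      where
      open ≡.≡-Reasoning
      q∣k%r : q ∣ k % r
      q∣k%r = %-presˡ-∣ (*-cancelˡ-∣ p (subst (_∣ p * k) (≡.sym p*q≡r) r∣pk)) (divides p (≡.sym p*q≡r))
      l<p : _∣_.quotient q∣k%r < p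
      l<p = *-cancelʳ-< _ _ _ (≡.subst₂ _<_ (_∣_.equality q∣k%r) (≡.sym p*q≡r) (m%n<n k r))

    Weight-residue : ∀ l {n a b xs} → All (Residue r p l) xs → Weight n a b xs →
      (a + b) % r ≡ (n * (l * q)) % r
    Weight-residue l {xs = []}            []        (weight refl refl refl) = refl
    Weight-residue l {xs = (i , j) ∷ xs} (eq ∷ eqs) (weight refl refl refl) = begin
      ((i + a) + (j + b)) % r                ≡⟨ cong (_% r) (interchange i a j b) ⟩
      ((i + j) + (a + b)) % r                ≡⟨ %-distribˡ-+ (i + j) (a + b) r ⟩
      ((i + j) % r + (a + b) % r) % r
        ≡⟨ cong (_% r) (cong₂ _+_ eq (Weight-residue l eqs (weight refl refl refl))) ⟩
      ((l * q) % r + (k * (l * q)) % r) % r  ≡⟨ %-distribˡ-+ (l * q) (k * (l * q)) r ⟨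
      (l * q + k * (l * q)) % r              ∎
      where
      open ≡.≡-Reasoning
      open import Algebra.Properties.CommutativeSemigroup +-commutativeSemigroup using (interchange)
      a = sum (map proj₁ xs)
      b = sum (map proj₂ xs)
      k = length xs

    -- This is where the formula for `d` enters. With `g = gcd (s * p) r` and `r = t * g`, one has
    -- `d * q * p = d * r = d * g * t = s * p * t`; cancelling `p` leaves `d * q = t * s`.
    s∣d*q : ∀ s → s ∣ d⟨ r , p , s ⟩ * q
    s∣d*q s with divides t r≡t*g ← gcd[m,n]∣n (s * p) r =
      divides t (*-cancelʳ-≡ (d * q) (t * s) p (begin
        d * q * p                    ≡⟨ *-assoc d q p ⟩
        d * (q * p)                  ≡⟨ cong (d *_) (m/n*n≡m p∣r) ⟩
        d * r                        ≡⟨ cong (d *_) (≡.trans r≡t*g (*-comm t _)) ⟩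
        d * (gcd (s * p) r * t)      ≡⟨ *-assoc d _ t ⟨
        d * gcd (s * p) r * t        ≡⟨ cong (_* t) (m/n*n≡m (gcd[m,n]∣m (s * p) r)) ⟩
        s * p * t                    ≡⟨ *-comm (s * p) t ⟩
        t * (s * p)                  ≡⟨ *-assoc t s p ⟨
        t * s * p                    ∎))
      where
      open ≡.≡-Reasoning
      instance
        gcd≢0 : NonZero (gcd (s * p) r)
        gcd≢0 = ≢-nonZero (gcd[m,n]≢0 (s * p) r (inj₂ (≢-nonZero⁻¹ r)))
      d = (s * p) / gcd (s * p) r

    -- The congruences of the `n` cells add up to `a + b ≡ n * (l * q)` modulo `r`, and as `s ∣ r`
    -- this can be read modulo `s`.
    Weight-divisible : ∀ s → s ∣ r → ∀ l {n a b xs} → d⟨ r , p , s ⟩ ∣ n →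
      All (Residue r p l) xs → Weight n a b xs → s ∣ a → s ∣ b
    Weight-divisible s s∣r l {n} {a} {b} d∣n res w s∣a = ∣m+n∣m⇒∣n
      (∣n∣m%n⇒∣m s∣r (subst (s ∣_) (≡.sym (Weight-residue l res w)) (%-presˡ-∣ s∣n*lq s∣r))) s∣a
      where
      s∣n*lq : s ∣ n * (l * q)
      s∣n*lq = subst (s ∣_) (≡.sym (x∙yz≈y∙xz n l q))
        (∣n⇒∣m*n l (∣-trans (s∣d*q s) (*-monoˡ-∣ q d∣n)))
        where
        open import Algebra.Properties.CommutativeSemigroup *-commutativeSemigroup using (x∙yz≈y∙xz)

  -- Exponents are natural numbers, so `pred r` stands for -1 modulo `r`; the claim follows by
  -- adding `k₀` to `k - k₀ ≡ 0`.
  opposite-residue : ∀ {r} .{{_ : NonZero r}} k k₀ → (k + pred r * k₀) % r ≡ 0 → k % r ≡ k₀ % r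
  opposite-residue {r} k k₀ eq = begin
    k % r                          ≡⟨ [m+kn]%n≡m%n k k₀ r ⟨
    (k + k₀ * r) % r
      ≡⟨ cong (λ x → (k + x) % r) (≡.trans (*-comm k₀ r) (cong (_* k₀) (≡.sym (suc-pred r)))) ⟩
    (k + (k₀ + pred r * k₀)) % r   ≡⟨ cong (λ x → (k + x) % r) (+-comm k₀ _) ⟩
    (k + (pred r * k₀ + k₀)) % r   ≡⟨ cong (_% r) (≡.sym (+-assoc k _ k₀)) ⟩
    (k + pred r * k₀ + k₀) % r     ≡⟨ %-remove-+ˡ k₀ (m%n≡0⇒n∣m _ r eq) ⟩
    k₀ % r                         ∎
    where open ≡.≡-Reasoning

-- Finite sums and products with at most one nontrivial term

module SingleTerm {c ℓ} (M : CommutativeMonoid c ℓ) where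
  open CommutativeMonoid M
  open import Algebra.Properties.CommutativeMonoid.Sum M

  sum-zero : ∀ {n} (f : Fin n → Carrier) → (∀ i → f i ≈ ε) → sum f ≈ ε
  sum-zero {n} f f≈ε = trans (sum-cong-≋ f≈ε) (sum-replicate-zero n)

  sum-single : ∀ {n} (k : Fin n) (f : Fin n → Carrier) → (∀ i → i ≢ k → f i ≈ ε) → sum f ≈ f k
  sum-single {suc n} k f f≈ε = trans (sum-remove f) (trans
    (∙-congˡ (sum-zero (f ∘ punchIn k) (λ i → f≈ε (punchIn k i) (Fin.punchInᵢ≢i k i))))
    (identityʳ (f k)))

module ℕSum where
  open import Algebra.Properties.Semiring.Sum ℕ.+-*-semiring public
  open SingleTerm ℕ.+-0-commutativeMonoid public

open ℕSum using () renaming (sum to Σℕ)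

-- Exponent vectors of products and of permuted monomials

lookup-injective : ∀ {A : Set} {n} {v w : Vec A n} → (∀ i → lookup v i ≡ lookup w i) → v ≡ w
lookup-injective {v = v} {w} v≗w = begin
  v                    ≡⟨ Vec.tabulate∘lookup v ⟨
  tabulate (lookup v)  ≡⟨ Vec.tabulate-cong v≗w ⟩
  tabulate (lookup w)  ≡⟨ Vec.tabulate∘lookup w ⟩
  w                    ∎
  where open ≡.≡-Reasoning

infixr 8 _∘ₘ_
_∘ₘ_ : ∀ {n} → Mon n → (Fin n → Fin n) → Mon n
(α , β) ∘ₘ σ = tabulate (lookup α ∘ σ) , tabulate (lookup β ∘ σ)

∘ₘ-inverse : ∀ {n} {σ τ : Fin n → Fin n} → (∀ i → τ (σ i) ≡ i) → (m : Mon n) → (m ∘ₘ τ) ∘ₘ σ ≡ m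
∘ₘ-inverse {σ = σ} {τ} τσ (α , β) = cong₂ _,_ (inverse α) (inverse β)
  where
  inverse : ∀ α → tabulate (lookup (tabulate (lookup α ∘ τ)) ∘ σ) ≡ α
  inverse α = lookup-injective λ i → begin
    lookup (tabulate (lookup (tabulate (lookup α ∘ τ)) ∘ σ)) i  ≡⟨ Vec.lookup∘tabulate _ i ⟩
    lookup (tabulate (lookup α ∘ τ)) (σ i)                      ≡⟨ Vec.lookup∘tabulate _ (σ i) ⟩
    lookup α (τ (σ i))                                          ≡⟨ cong (lookup α) (τσ i) ⟩
    lookup α i                                                  ∎
    where open ≡.≡-Reasoning

sum-zipWith-+ : ∀ {n} (α β : Vec ℕ n) → Vec.sum (zipWith ℕ._+_ α β) ≡ Vec.sum α ℕ.+ Vec.sum β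
sum-zipWith-+ Vec.[] Vec.[] = refl
sum-zipWith-+ (a Vec.∷ α) (b Vec.∷ β) = begin
  (a ℕ.+ b) ℕ.+ Vec.sum (zipWith ℕ._+_ α β)    ≡⟨ cong (a ℕ.+ b ℕ.+_) (sum-zipWith-+ α β) ⟩
  (a ℕ.+ b) ℕ.+ (Vec.sum α ℕ.+ Vec.sum β)      ≡⟨ interchange a b _ _ ⟩
  (a ℕ.+ Vec.sum α) ℕ.+ (b ℕ.+ Vec.sum β)      ∎
  where
  open ≡.≡-Reasoning
  open import Algebra.Properties.CommutativeSemigroup ℕ.+-commutativeSemigroup using (interchange)

sum-𝟎 : ∀ n → Vec.sum (𝟎 {n}) ≡ 0
sum-𝟎 zero    = refl
sum-𝟎 (suc n) = sum-𝟎 n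

-- `mon^` and `mon∏` repeat on exponents the recursions of `_^ₚ_` and `∏ₚ`, so that a product of
-- single terms can be followed constructor by constructor.
mon^ : ∀ {n} → Mon n → ℕ → Mon n
mon^ μ zero    = 𝟎 , 𝟎
mon^ μ (suc k) = μ ∙ₘ mon^ μ k

mon∏ : ∀ {n k} → (Fin k → Mon n) → Mon n
mon∏ = Vector.foldr _∙ₘ_ (𝟎 , 𝟎)

module _ {n} (exps : Mon n → Vec ℕ n) (exps-𝟎 : exps (𝟎 , 𝟎) ≡ 𝟎)
         (exps-∙ : ∀ μ ν → exps (μ ∙ₘ ν) ≡ zipWith ℕ._+_ (exps μ) (exps ν)) (t : Fin n) where

  private
    at-𝟎 : lookup (exps (𝟎 , 𝟎)) t ≡ 0
    at-𝟎 = ≡.trans (cong (λ v → lookup v t) exps-𝟎) (Vec.lookup-replicate t 0)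

    at-∙ : ∀ μ ν → lookup (exps (μ ∙ₘ ν)) t ≡ lookup (exps μ) t ℕ.+ lookup (exps ν) t
    at-∙ μ ν = ≡.trans (cong (λ v → lookup v t) (exps-∙ μ ν))
      (Vec.lookup-zipWith ℕ._+_ t (exps μ) (exps ν))

  -- The abstract `exps` is later `proj₁` or `proj₂`, which treats the x- and the y-exponents by one
  -- argument.
  lookup-mon^ : ∀ μ k → lookup (exps (mon^ μ k)) t ≡ k ℕ.* lookup (exps μ) t
  lookup-mon^ μ zero    = at-𝟎
  lookup-mon^ μ (suc k) =
    ≡.trans (at-∙ μ (mon^ μ k)) (cong (lookup (exps μ) t ℕ.+_) (lookup-mon^ μ k))

  lookup-mon∏ : ∀ {k} (F : Fin k → Mon n) →
    lookup (exps (mon∏ F)) t ≡ Σℕ (λ i → lookup (exps (F i)) t)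
  lookup-mon∏ {zero}  F = at-𝟎
  lookup-mon∏ {suc k} F =
    ≡.trans (at-∙ (F zero) _) (cong (lookup (exps (F zero)) t ℕ.+_) (lookup-mon∏ (F ∘ suc)))

lookup-𝐞 : ∀ {n} (j : Fin n) → lookup (𝐞 j) j ≡ 1
lookup-𝐞 j = Vec.lookup∘update j 𝟎 1

lookup-𝐞′ : ∀ {n} (i j : Fin n) → i ≢ j → lookup (𝐞 j) i ≡ 0
lookup-𝐞′ i j i≢j = ≡.trans (Vec.lookup∘update′ i≢j 𝟎 1) (Vec.lookup-replicate i 0)

module _ {n} {σ τ : Fin n → Fin n} (τσ : ∀ i → τ (σ i) ≡ i) (στ : ∀ i → σ (τ i) ≡ i) where

  private
    permuted : ∀ (α : Vec ℕ n) t → Σℕ (λ i → lookup α i ℕ.* lookup (𝐞 (σ i)) t) ≡ lookup α (τ t)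
    permuted α t = begin
      Σℕ (λ i → lookup α i ℕ.* lookup (𝐞 (σ i)) t)  ≡⟨ ℕSum.sum-single (τ t) _ off ⟩
      lookup α (τ t) ℕ.* lookup (𝐞 (σ (τ t))) t
        ≡⟨ cong (λ k → lookup α (τ t) ℕ.* lookup (𝐞 k) t) (στ t) ⟩
      lookup α (τ t) ℕ.* lookup (𝐞 t) t             ≡⟨ cong (lookup α (τ t) ℕ.*_) (lookup-𝐞 t) ⟩
      lookup α (τ t) ℕ.* 1                          ≡⟨ ℕ.*-identityʳ _ ⟩
      lookup α (τ t)                                ∎
      where
      open ≡.≡-Reasoning
      off : ∀ i → i ≢ τ t → lookup α i ℕ.* lookup (𝐞 (σ i)) t ≡ 0
      off i i≢τt = ≡.trans
        (cong (lookup α i ℕ.*_) (lookup-𝐞′ t (σ i) λ { refl → i≢τt (≡.sym (τσ i)) }))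
        (ℕ.*-zeroʳ (lookup α i))

    untouched : ∀ (α : Vec ℕ n) t → Σℕ (λ i → lookup α i ℕ.* lookup (𝟎 {n}) t) ≡ 0
    untouched α t = ℕSum.sum-zero _ λ i →
      ≡.trans (cong (lookup α i ℕ.*_) (Vec.lookup-replicate t 0)) (ℕ.*-zeroʳ (lookup α i))

    module _ {μ : Fin n → Mon n} (exps : Mon n → Vec ℕ n) (exps-𝟎 : exps (𝟎 , 𝟎) ≡ 𝟎)
         (exps-∙ : ∀ μ ν → exps (μ ∙ₘ ν) ≡ zipWith ℕ._+_ (exps μ) (exps ν)) where
      expand : ∀ α t → lookup (exps (mon∏ (λ i → mon^ (μ i) (lookup α i)))) t ≡
                       Σℕ (λ i → lookup α i ℕ.* lookup (exps (μ i)) t)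
      expand α t = ≡.trans (lookup-mon∏ exps exps-𝟎 exps-∙ t (λ i → mon^ (μ i) (lookup α i)))
        (ℕSum.sum-cong-≗ λ i → lookup-mon^ exps exps-𝟎 exps-∙ t (μ i) (lookup α i))

  -- Substituting variable `σ i` for variable `i`: variable `t` receives an exponent only from
  -- `i = τ t`.
  mon∏-permuted : (α β : Vec ℕ n) →
    mon∏ (λ i → mon^ (𝐞 (σ i) , 𝟎) (lookup α i)) ∙ₘ mon∏ (λ i → mon^ (𝟎 , 𝐞 (σ i)) (lookup β i)) ≡
    (α , β) ∘ₘ τ
  mon∏-permuted α β = cong₂ _,_
    (lookup-injective λ t → begin
      _ ≡⟨ Vec.lookup-zipWith ℕ._+_ t (proj₁ (mon∏ X)) (proj₁ (mon∏ Y)) ⟩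
      lookup (proj₁ (mon∏ X)) t ℕ.+ lookup (proj₁ (mon∏ Y)) t
        ≡⟨ cong₂ ℕ._+_ (≡.trans (expand proj₁ refl (λ _ _ → refl) α t) (permuted α t))
                       (≡.trans (expand proj₁ refl (λ _ _ → refl) β t) (untouched β t)) ⟩
      lookup α (τ t) ℕ.+ 0          ≡⟨ ℕ.+-identityʳ _ ⟩
      lookup α (τ t)                ≡⟨ Vec.lookup∘tabulate _ t ⟨
      _                             ∎)
    (lookup-injective λ t → begin
      _ ≡⟨ Vec.lookup-zipWith ℕ._+_ t (proj₂ (mon∏ X)) (proj₂ (mon∏ Y)) ⟩
      lookup (proj₂ (mon∏ X)) t ℕ.+ lookup (proj₂ (mon∏ Y)) t
        ≡⟨ cong₂ ℕ._+_ (≡.trans (expand proj₂ refl (λ _ _ → refl) α t) (untouched α t))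
                       (≡.trans (expand proj₂ refl (λ _ _ → refl) β t) (permuted β t)) ⟩
      lookup β (τ t)                ≡⟨ Vec.lookup∘tabulate _ t ⟨
      _                             ∎)
    where
    open ≡.≡-Reasoning
    X = λ i → mon^ (𝐞 (σ i) , 𝟎) (lookup α i)
    Y = λ i → mon^ (𝟎 , 𝐞 (σ i)) (lookup β i)

module Polynomials {c ℓ₁ ℓ₂ : Level} (K : HeytingField c ℓ₁ ℓ₂) where

  commutativeRing : CommutativeRing c ℓ₁
  commutativeRing = HeytingCommutativeRing.commutativeRing
    (HeytingField.heytingCommutativeRing K)

  open CommutativeRing commutativeRing hiding (zero) renaming (refl to ≈-refl)
  open import Algebra.Properties.CommutativeSemiring.Exp commutativeSemiring
  open import Algebra.Properties.CommutativeMonoid.Sum +-commutativeMonoid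
    using (sum; sum-cong-≋)
  open SingleTerm +-commutativeMonoid
  open import Algebra.Properties.CommutativeMonoid.Sum *-commutativeMonoid
    using () renaming (sum to ∏; sum-cong-≋ to ∏-cong; ∑-distrib-+ to ∏-distrib-*)
  open import Algebra.Properties.CommutativeSemigroup *-commutativeSemigroup
    using () renaming (interchange to *-interchange)
  open import Relation.Binary.Reasoning.Setoid setoid

  -- Polynomials as formal sums paired with functions on monomials

  infixr 5 _·_

  δ : ∀ {n} → Mon n → Mon n → Carrier
  δ μ m = if does (μ ≟ₘ m) then 1# else 0#

  -- The value at f of the linear functional on polynomials given by φ on monomials
  _·_ : ∀ {n} → Poly K n → (Mon n → Carrier) → Carrier
  []            · φ = 0#
  ((a , μ) ∷ f) · φ = a * φ μ + (f · φ)

  ·-congˡ : ∀ {n} (f : Poly K n) {φ ψ : Mon n → Carrier} → (∀ μ → φ μ ≈ ψ μ) → f · φ ≈ f · ψ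
  ·-congˡ []            φ≈ψ = ≈-refl
  ·-congˡ ((a , μ) ∷ f) φ≈ψ = +-cong (*-congˡ (φ≈ψ μ)) (·-congˡ f φ≈ψ)

  ·-zero : ∀ {n} (f : Poly K n) {φ : Mon n → Carrier} → (∀ μ → φ μ ≈ 0#) → f · φ ≈ 0#
  ·-zero []            φ≈0 = ≈-refl
  ·-zero ((a , μ) ∷ f) φ≈0 =
    trans (+-cong (trans (*-congˡ (φ≈0 μ)) (zeroʳ a)) (·-zero f φ≈0)) (+-identityʳ 0#)

  ·-scale : ∀ {n} (f : Poly K n) x (φ : Mon n → Carrier) → f · (λ μ → x * φ μ) ≈ x * (f · φ)
  ·-scale []            x φ = sym (zeroʳ x)
  ·-scale ((a , μ) ∷ f) x φ = begin
    a * (x * φ μ) + (f · λ μ → x * φ μ)  ≈⟨ +-cong (x∙yz≈y∙xz a x (φ μ)) (·-scale f x φ) ⟩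
    x * (a * φ μ) + x * (f · φ)          ≈⟨ distribˡ x _ _ ⟨
    x * (a * φ μ + (f · φ))              ∎
    where
    open import Algebra.Properties.CommutativeSemigroup *-commutativeSemigroup using (x∙yz≈y∙xz)

  coeff-· : ∀ {n} (f : Poly K n) m → coeff K f m ≈ f · (λ μ → δ μ m)
  coeff-· []            m = ≈-refl
  coeff-· ((a , μ) ∷ f) m = +-cong (term (μ ≟ₘ m)) (coeff-· f m)
    where
    term : (d : Dec (μ ≡ m)) → (if does d then a else 0#) ≈ a * (if does d then 1# else 0#)
    term (yes _) = sym (*-identityʳ a)
    term (no _)  = sym (zeroʳ a)

  ++-· : ∀ {n} (f g : Poly K n) φ → (f ++ g) · φ ≈ (f · φ) + (g · φ)
  ++-· []            g φ = sym (+-identityˡ _)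
  ++-· ((a , μ) ∷ f) g φ = trans (+-congˡ (++-· f g φ)) (sym (+-assoc _ _ _))

  •-· : ∀ {n} a (f : Poly K n) φ → (_•_ K a f) · φ ≈ a * (f · φ)
  •-· a []            φ = sym (zeroʳ a)
  •-· a ((b , μ) ∷ f) φ = trans (+-cong (*-assoc a b (φ μ)) (•-· a f φ)) (sym (distribˡ a _ _))

  *ₚ-· : ∀ {n} (f g : Poly K n) φ → (_*ₚ_ K f g) · φ ≈ f · (λ μ → g · (λ ν → φ (μ ∙ₘ ν)))
  *ₚ-· []            g φ = ≈-refl
  *ₚ-· ((a , μ) ∷ f) g φ = trans (++-· (List.map _ g) _ φ) (+-cong (term g) (*ₚ-· f g φ))
    where
    term : ∀ g → List.map (λ (b , ν) → a * b , μ ∙ₘ ν) g · φ ≈ a * (g · (λ ν → φ (μ ∙ₘ ν)))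
    term []            = sym (zeroʳ a)
    term ((b , ν) ∷ g) = trans (+-cong (*-assoc a b _) (term g)) (sym (distribˡ a _ _))

  Σₚ-· : ∀ {n k} (F : Fin k → Poly K n) φ → Σₚ K F · φ ≈ sum (λ i → F i · φ)
  Σₚ-· {k = zero}  F φ = ≈-refl
  Σₚ-· {k = suc k} F φ = trans (++-· (F zero) _ φ) (+-congˡ (Σₚ-· (F ∘ suc) φ))

  coeff-++ : ∀ {n} (f g : Poly K n) m → coeff K (f ++ g) m ≈ coeff K f m + coeff K g m
  coeff-++ f g m = trans (coeff-· (f ++ g) m)
    (trans (++-· f g _) (+-cong (sym (coeff-· f m)) (sym (coeff-· g m))))

  coeff-• : ∀ {n} a (f : Poly K n) m → coeff K (_•_ K a f) m ≈ a * coeff K f m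
  coeff-• a f m = trans (coeff-· (_•_ K a f) m) (trans (•-· a f _) (*-congˡ (sym (coeff-· f m))))

  coeff-Σₚ : ∀ {n k} (F : Fin k → Poly K n) m → coeff K (Σₚ K F) m ≈ sum (λ i → coeff K (F i) m)
  coeff-Σₚ F m = trans (coeff-· (Σₚ K F) m)
    (trans (Σₚ-· F _) (sum-cong-≋ λ i → sym (coeff-· (F i) m)))

  act-· : ∀ {n} (A : Matrix K n) f φ → act K A f · φ ≈ f · (λ μ → actMon K A μ · φ)
  act-· A []            φ = ≈-refl
  act-· A ((a , μ) ∷ f) φ =
    trans (++-· (_•_ K a (actMon K A μ)) _ φ) (+-cong (•-· a (actMon K A μ) φ) (act-· A f φ))

  erase : ∀ {n} → Mon n → Poly K n → Poly K n
  erase μ = filter (λ (_ , ν) → ¬? (ν ≟ₘ μ))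

  ·-erase : ∀ {n} (f : Poly K n) μ φ → f · φ ≈ coeff K f μ * φ μ + (erase μ f · φ)
  ·-erase []            μ φ = sym (trans (+-identityʳ _) (zeroˡ _))
  ·-erase ((a , ν) ∷ f) μ φ with ν ≟ₘ μ
  ... | yes refl = begin
    a * φ μ + (f · φ)                                     ≈⟨ +-congˡ (·-erase f μ φ) ⟩
    a * φ μ + (coeff K f μ * φ μ + (erase μ f · φ))       ≈⟨ +-assoc _ _ _ ⟨
    a * φ μ + coeff K f μ * φ μ + (erase μ f · φ)         ≈⟨ +-congʳ (distribʳ _ _ _) ⟨
    (a + coeff K f μ) * φ μ + (erase μ f · φ)             ∎
  ... | no _ = begin
    a * φ ν + (f · φ)                                     ≈⟨ +-congˡ (·-erase f μ φ) ⟩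
    a * φ ν + (coeff K f μ * φ μ + (erase μ f · φ))       ≈⟨ x∙yz≈y∙xz _ _ _ ⟩
    coeff K f μ * φ μ + (a * φ ν + (erase μ f · φ))       ≈⟨ +-congʳ (*-congʳ (+-identityˡ _)) ⟨
    (0# + coeff K f μ) * φ μ + (a * φ ν + (erase μ f · φ)) ∎
    where
    open import Algebra.Properties.CommutativeSemigroup
      (CommutativeMonoid.commutativeSemigroup +-commutativeMonoid) using (x∙yz≈y∙xz)

  coeff-erase-≡ : ∀ {n} (f : Poly K n) μ → coeff K (erase μ f) μ ≈ 0#
  coeff-erase-≡ []            μ = ≈-refl
  coeff-erase-≡ ((a , ν) ∷ f) μ with ν ≟ₘ μ in eq
  ... | yes _ = coeff-erase-≡ f μ
  ... | no _ rewrite eq = trans (+-identityˡ _) (coeff-erase-≡ f μ)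

  coeff-erase-≢ : ∀ {n} (f : Poly K n) μ m → μ ≢ m → coeff K (erase μ f) m ≈ coeff K f m
  coeff-erase-≢ []            μ m μ≢m = ≈-refl
  coeff-erase-≢ ((a , ν) ∷ f) μ m μ≢m with ν ≟ₘ μ
  ... | no _ = +-congˡ (coeff-erase-≢ f μ m μ≢m)
  ... | yes refl with ν ≟ₘ m
  ...   | yes ν≡m = contradiction ν≡m μ≢m
  ...   | no _    = trans (coeff-erase-≢ f μ m μ≢m) (sym (+-identityˡ _))

  -- Where a coefficient vanishes, the single terms contributing to it need not. All terms with the
  -- head monomial are therefore collected into one coefficient and erased; the remaining list is
  -- not a sublist known to the termination checker, so the induction runs on a bound for its
  -- length.
  ·-vanish : ∀ {n} (f : Poly K n) φ → (∀ μ → coeff K f μ ≈ 0# ⊎ φ μ ≈ 0#) → f · φ ≈ 0#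
  ·-vanish f φ = go (length f) f ℕ.≤-refl
    where
    go : ∀ k f → length f ≤ k → (∀ μ → coeff K f μ ≈ 0# ⊎ φ μ ≈ 0#) → f · φ ≈ 0#
    go _       []              _         _    = ≈-refl
    go (suc k) f@((a , μ) ∷ g) (s≤s g≤k) zero∨ = begin
      f · φ                                  ≈⟨ ·-erase f μ φ ⟩
      coeff K f μ * φ μ + (erase μ f · φ)    ≈⟨ +-cong product (go k (erase μ f) shorter rest) ⟩
      0# + 0#                                ≈⟨ +-identityʳ 0# ⟩
      0#                                     ∎
      where
      product : coeff K f μ * φ μ ≈ 0#
      product = [ (λ c≈0 → trans (*-congʳ c≈0) (zeroˡ _))
                , (λ φ≈0 → trans (*-congˡ φ≈0) (zeroʳ _)) ]′ (zero∨ μ)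
      shorter : length (erase μ f) ≤ k
      shorter with μ ≟ₘ μ
      ... | yes _  = ℕ.≤-trans (List.length-filter _ g) g≤k
      ... | no μ≢μ = contradiction refl μ≢μ
      rest : ∀ m → coeff K (erase μ f) m ≈ 0# ⊎ φ m ≈ 0#
      rest m with μ ≟ₘ m
      ... | yes refl = inj₁ (coeff-erase-≡ f μ)
      ... | no μ≢m   = [ (λ c≈0 → inj₁ (trans (coeff-erase-≢ f μ m μ≢m) c≈0)) , inj₂ ]′ (zero∨ m)

  if-yes : ∀ {P : Set} (d : Dec P) {x y : Carrier} → P → (if does d then x else y) ≈ x
  if-yes (yes _) _ = ≈-refl
  if-yes (no ¬p) p = contradiction p ¬p

  if-no : ∀ {P : Set} (d : Dec P) {x y : Carrier} → ¬ P → (if does d then x else y) ≈ y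
  if-no (yes p) ¬p = contradiction p ¬p
  if-no (no _)  _  = ≈-refl

  δ-≢ : ∀ {n} (μ m : Mon n) → μ ≢ m → δ μ m ≈ 0#
  δ-≢ μ m = if-no (μ ≟ₘ m)

  δ-≡ : ∀ {n} (μ : Mon n) → δ μ μ ≈ 1#
  δ-≡ μ = if-yes (μ ≟ₘ μ) refl

  -- Supports of elements of the subalgebra S_s[X,Y]

  Divisible : ∀ {n} → ℕ → Mon n → Set
  Divisible s m = s ∣ degˣ m × s ∣ degʸ m

  Divisible-∙ : ∀ {n} {s} {μ ν : Mon n} → Divisible s μ → Divisible s ν → Divisible s (μ ∙ₘ ν)
  Divisible-∙ {s = s} {α , β} {α′ , β′} (p , q) (p′ , q′) =
    subst (s ∣_) (≡.sym (sum-zipWith-+ α α′)) (∣m∣n⇒∣m+n p p′) ,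
    subst (s ∣_) (≡.sym (sum-zipWith-+ β β′)) (∣m∣n⇒∣m+n q q′)

  Divisible? : ∀ {n} s (m : Mon n) → Dec (Divisible s m)
  Divisible? s m = (s ∣? degˣ m) ×-dec (s ∣? degʸ m)

  -- Every constructor preserves this support condition. For products, deciding divisibility of
  -- exponents supplies the alternatives that `·-vanish` asks for: if both factors of a monomial are
  -- divisible, so is their product, which then differs from `m`.
  S-coeff : ∀ {n s} {f : Poly K n} → S[X,Y] K s f → ∀ m → ¬ Divisible s m → coeff K f m ≈ 0#
  S-coeff {n} {s} one m ¬div = trans (coeff-· (1ₚ K) m)
    (trans (+-congʳ (*-congˡ (δ-≢ (𝟎 , 𝟎) m λ { refl → ¬div (div𝟎 , div𝟎) })))
      (trans (+-identityʳ _) (zeroʳ 1#)))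
    where
    div𝟎 : s ∣ Vec.sum (𝟎 {n})
    div𝟎 = subst (s ∣_) (≡.sym (sum-𝟎 n)) (s ∣0)
  S-coeff (gen μ p q) m ¬div = trans (coeff-· (mono K μ) m)
    (trans (+-congʳ (*-congˡ (δ-≢ μ m λ { refl → ¬div (p , q) })))
      (trans (+-identityʳ _) (zeroʳ 1#)))
  S-coeff (plus {f} {g} F G) m ¬div = trans (coeff-++ f g m)
    (trans (+-cong (S-coeff F m ¬div) (S-coeff G m ¬div)) (+-identityʳ 0#))
  S-coeff {s = s} (times {f} {g} F G) m ¬div = begin
    coeff K (_*ₚ_ K f g) m                         ≈⟨ coeff-· (_*ₚ_ K f g) m ⟩
    (_*ₚ_ K f g · λ μ → δ μ m)                     ≈⟨ *ₚ-· f g _ ⟩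
    (f · λ μ → g · λ ν → δ (μ ∙ₘ ν) m)             ≈⟨ ·-vanish f _ outer ⟩
    0#                                             ∎
    where
    outer : ∀ μ → coeff K f μ ≈ 0# ⊎ (g · λ ν → δ (μ ∙ₘ ν) m) ≈ 0#
    outer μ with Divisible? s μ
    ... | no ¬divμ = inj₁ (S-coeff F μ ¬divμ)
    ... | yes divμ = inj₂ (·-vanish g _ inner)
      where
      inner : ∀ ν → coeff K g ν ≈ 0# ⊎ δ (μ ∙ₘ ν) m ≈ 0#
      inner ν with Divisible? s ν
      ... | no ¬divν = inj₁ (S-coeff G ν ¬divν)
      ... | yes divν = inj₂ (δ-≢ (μ ∙ₘ ν) m λ { refl → ¬div (Divisible-∙ {μ = μ} {ν} divμ divν) })
  S-coeff (scale a {f} F) m ¬div = trans (coeff-• a f m) (trans (*-congˡ (S-coeff F m ¬div)) (zeroʳ a))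
  S-coeff (resp f≈g F) m ¬div = trans (sym (f≈g m)) (S-coeff F m ¬div)

  -- f ≈ₚ v μ, tested on all linear functionals rather than on coefficients, so
  -- that products need no congruence of _*ₚ_ with respect to _≈ₚ_
  record IsTerm {n} (f : Poly K n) (v : Carrier) (μ : Mon n) : Set (c ⊔ ℓ₁) where
    constructor isTerm
    field evaluate : ∀ φ → f · φ ≈ v * φ μ
  open IsTerm

  mono-isTerm : ∀ {n} (μ : Mon n) → IsTerm (mono K μ) 1# μ
  mono-isTerm μ = isTerm λ φ → +-identityʳ _

  *ₚ-isTerm : ∀ {n} {f g : Poly K n} {v w μ ν} → IsTerm f v μ → IsTerm g w ν →
    IsTerm (_*ₚ_ K f g) (v * w) (μ ∙ₘ ν)
  *ₚ-isTerm {f = f} {g} {v} {w} {μ} {ν} F G = isTerm λ φ → begin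
    _*ₚ_ K f g · φ                         ≈⟨ *ₚ-· f g φ ⟩
    (f · λ μ → g · λ ν → φ (μ ∙ₘ ν))       ≈⟨ evaluate F _ ⟩
    v * (g · λ ν → φ (μ ∙ₘ ν))             ≈⟨ *-congˡ (evaluate G _) ⟩
    v * (w * φ (μ ∙ₘ ν))                   ≈⟨ *-assoc _ _ _ ⟨
    v * w * φ (μ ∙ₘ ν)                     ∎

  ^ₚ-isTerm : ∀ {n} {f : Poly K n} {v μ} → IsTerm f v μ → ∀ k → IsTerm (_^ₚ_ K f k) (v ^ k) (mon^ μ k)
  ^ₚ-isTerm F zero    = mono-isTerm _
  ^ₚ-isTerm F (suc k) = *ₚ-isTerm F (^ₚ-isTerm F k)

  ∏ₚ-isTerm : ∀ {n k} {F : Fin k → Poly K n} {v μ} → (∀ i → IsTerm (F i) (v i) (μ i)) →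
    IsTerm (∏ₚ K F) (∏ v) (mon∏ μ)
  ∏ₚ-isTerm {k = zero}  F = mono-isTerm _
  ∏ₚ-isTerm {k = suc k} F = *ₚ-isTerm (F zero) (∏ₚ-isTerm (F ∘ suc))

  -- Monomial matrices: their action and their determinant

  Supported : ∀ {n} → Matrix K n → (Fin n → Fin n) → Set ℓ₁
  Supported A σ = ∀ i j → j ≢ σ i → A i j ≈ 0#

  row-isTerm : ∀ {n} {A : Matrix K n} {σ} → Supported A σ → ∀ i (μ : Fin n → Mon n) →
    IsTerm (Σₚ K (λ j → _•_ K (A i j) (mono K (μ j)))) (A i (σ i)) (μ (σ i))
  row-isTerm {A = A} {σ} supp i μ = isTerm λ φ → begin
    Σₚ K (λ j → _•_ K (A i j) (mono K (μ j))) · φ    ≈⟨ Σₚ-· (λ j → _•_ K (A i j) (mono K (μ j))) φ ⟩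
    sum (λ j → _•_ K (A i j) (mono K (μ j)) · φ)
      ≈⟨ sum-cong-≋ (λ j → trans (•-· (A i j) (mono K (μ j)) φ)
           (*-congˡ (trans (evaluate (mono-isTerm (μ j)) φ) (*-identityˡ _)))) ⟩
    sum (λ j → A i j * φ (μ j))
      ≈⟨ sum-single (σ i) _ (λ j j≢ → trans (*-congʳ (supp i j j≢)) (zeroˡ _)) ⟩
    A i (σ i) * φ (μ (σ i))                           ∎

  -- The scalar that a monomial matrix with entry `v i` in row `i` puts in front of the permuted
  -- monomial; for a diagonal matrix it is the eigenvalue.
  character : ∀ {n} → (Fin n → Carrier) → Mon n → Carrier
  character v (α , β) = ∏ (λ i → v i ^ lookup α i) * ∏ (λ i → v i ^ lookup β i)

  module _ {n} {A : Matrix K n} {σ τ : Fin n → Fin n} (supp : Supported A σ)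
           (τσ : ∀ i → τ (σ i) ≡ i) (στ : ∀ i → σ (τ i) ≡ i) where

    private
      χ : Mon n → Carrier
      χ = character (λ i → A i (σ i))

    actMon-isTerm : ∀ μ → IsTerm (actMon K A μ) (χ μ) (μ ∘ₘ τ)
    actMon-isTerm (α , β) = subst (IsTerm (actMon K A (α , β)) (χ (α , β))) (mon∏-permuted τσ στ α β)
      (*ₚ-isTerm
        (∏ₚ-isTerm λ i → ^ₚ-isTerm (row-isTerm supp i (λ j → 𝐞 j , 𝟎)) (lookup α i))
        (∏ₚ-isTerm λ i → ^ₚ-isTerm (row-isTerm supp i (λ j → 𝟎 , 𝐞 j)) (lookup β i)))

    -- The action sends `μ` to a multiple of `μ ∘ₘ τ`, so the coefficient at `m` comes from the
    -- unique preimage `m ∘ₘ σ`.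
    coeff-act : ∀ f m → coeff K (act K A f) m ≈ χ (m ∘ₘ σ) * coeff K f (m ∘ₘ σ)
    coeff-act f m = begin
      coeff K (act K A f) m                        ≈⟨ coeff-· (act K A f) m ⟩
      (act K A f · λ μ → δ μ m)                    ≈⟨ act-· A f _ ⟩
      (f · λ μ → actMon K A μ · λ μ → δ μ m)
        ≈⟨ ·-congˡ f (λ μ → trans (evaluate (actMon-isTerm μ) _) (shift μ)) ⟩
      (f · λ μ → χ (m ∘ₘ σ) * δ μ (m ∘ₘ σ))        ≈⟨ ·-scale f _ _ ⟩
      χ (m ∘ₘ σ) * (f · λ μ → δ μ (m ∘ₘ σ))        ≈⟨ *-congˡ (coeff-· f (m ∘ₘ σ)) ⟨
      χ (m ∘ₘ σ) * coeff K f (m ∘ₘ σ)              ∎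
      where
      shift : ∀ μ → χ μ * δ (μ ∘ₘ τ) m ≈ χ (m ∘ₘ σ) * δ μ (m ∘ₘ σ)
      shift μ with μ ≟ₘ (m ∘ₘ σ)
      ... | yes refl = *-congˡ
        (trans (reflexive (cong (λ m′ → δ m′ m) (∘ₘ-inverse {σ = τ} {σ} στ m))) (δ-≡ m))
      ... | no μ≢ = trans
        (*-congˡ (δ-≢ (μ ∘ₘ τ) m λ eq →
          μ≢ (≡.trans (≡.sym (∘ₘ-inverse {σ = σ} {τ} τσ μ)) (cong (_∘ₘ σ) eq))))
        (trans (zeroʳ _) (sym (zeroʳ _)))

  -- `ε` is the sign of `σ`, built up by Laplace expansion. It is chosen before `A`, so the same `ε`
  -- serves a matrix and its matrix of absolute values; `ε * ε ≈ 1#` then lets it cancel from the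
  -- ratio of determinants.
  det-monomial : ∀ n (σ : Fin n → Fin n) → Injective _≡_ _≡_ σ →
    ∃[ ε ] ε * ε ≈ 1# × (∀ A → Supported A σ → det K A ≈ ε * ∏ (λ i → A i (σ i)))
  det-monomial zero    σ inj = 1# , *-identityˡ 1# , λ A _ → sym (*-identityˡ 1#)
  det-monomial (suc n) σ inj = sgn * ε , square , expansion
    where
    σ0≢ : ∀ i → σ zero ≢ σ (suc i)
    σ0≢ i eq = contradiction (inj eq) λ ()
    σ′ : Fin n → Fin n
    σ′ i = punchOut (σ0≢ i)
    inj′ : Injective _≡_ _≡_ σ′
    inj′ eq = Fin.suc-injective (inj (Fin.punchOut-injective (σ0≢ _) (σ0≢ _) eq))
    minor-det = det-monomial n σ′ inj′
    ε     = proj₁ minor-det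
    ε²≈1  = proj₁ (proj₂ minor-det)
    det≈  = proj₂ (proj₂ minor-det)
    sgn : Carrier
    sgn = (- 1#) ^ toℕ (σ zero)
    sgn² : ∀ k → (- 1#) ^ k * (- 1#) ^ k ≈ 1#
    sgn² zero    = *-identityˡ 1#
    sgn² (suc k) = begin
      (- 1# * (- 1#) ^ k) * (- 1# * (- 1#) ^ k)    ≈⟨ *-interchange _ _ _ _ ⟩
      (- 1# * - 1#) * ((- 1#) ^ k * (- 1#) ^ k)    ≈⟨ *-cong -1*-1≈1 (sgn² k) ⟩
      1# * 1#                                      ≈⟨ *-identityˡ 1# ⟩
      1#                                           ∎
      where
      open import Algebra.Properties.Ring ring using (-‿distribˡ-*; -‿involutive)
      -1*-1≈1 : - 1# * - 1# ≈ 1#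
      -1*-1≈1 = trans (sym (-‿distribˡ-* 1# (- 1#))) (trans (-‿cong (*-identityˡ _)) (-‿involutive 1#))
    square : (sgn * ε) * (sgn * ε) ≈ 1#
    square = trans (*-interchange _ _ _ _) (trans (*-cong (sgn² (toℕ (σ zero))) ε²≈1) (*-identityˡ 1#))
    expansion : ∀ A → Supported A σ → det K A ≈ sgn * ε * ∏ (λ i → A i (σ i))
    expansion A supp = begin
      det K A
        ≈⟨ sum-single (σ zero) _ (λ j j≢ → trans
             (*-congʳ (trans (*-congˡ (supp zero j j≢)) (zeroʳ ((- 1#) ^ toℕ j))))
             (zeroˡ (det K (λ i k → A (suc i) (punchIn j k))))) ⟩
      sgn * A zero (σ zero) * det K minor
        ≈⟨ *-congˡ (det≈ minor minor-supp) ⟩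
      sgn * A zero (σ zero) * (ε * ∏ (λ i → minor i (σ′ i)))
        ≈⟨ *-interchange _ _ _ _ ⟩
      sgn * ε * (A zero (σ zero) * ∏ (λ i → minor i (σ′ i)))
        ≈⟨ *-congˡ (*-congˡ (∏-cong λ i →
             reflexive (cong (A (suc i)) (Fin.punchIn-punchOut (σ0≢ i))))) ⟩
      sgn * ε * (A zero (σ zero) * ∏ (λ i → A (suc i) (σ (suc i)))) ∎
      where
      minor : Matrix K n
      minor i k = A (suc i) (punchIn (σ zero) k)
      minor-supp : Supported minor σ′
      minor-supp i k k≢ = supp (suc i) _ λ eq → k≢
        (Fin.punchIn-injective (σ zero) _ _ (≡.trans eq (≡.sym (Fin.punchIn-punchOut (σ0≢ i)))))

-- Exponents of the diagonal test matrices

Σ-𝐞 : ∀ {n} (i : Fin n) (f : Fin n → ℕ) → Σℕ (λ t → lookup (𝐞 i) t ℕ.* f t) ≡ f i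
Σ-𝐞 i f = begin
  Σℕ (λ t → lookup (𝐞 i) t ℕ.* f t)
    ≡⟨ ℕSum.sum-single i _ (λ t t≢i → cong (ℕ._* f t) (lookup-𝐞′ t i t≢i)) ⟩
  lookup (𝐞 i) i ℕ.* f i             ≡⟨ cong (ℕ._* f i) (lookup-𝐞 i) ⟩
  1 ℕ.* f i                          ≡⟨ ℕ.*-identityˡ (f i) ⟩
  f i                                ∎
  where open ≡.≡-Reasoning

Σ-*𝐞 : ∀ {n} k (i : Fin n) (f : Fin n → ℕ) → Σℕ (λ t → (k ℕ.* lookup (𝐞 i) t) ℕ.* f t) ≡ k ℕ.* f i
Σ-*𝐞 k i f = begin
  Σℕ (λ t → (k ℕ.* lookup (𝐞 i) t) ℕ.* f t)
    ≡⟨ ℕSum.sum-cong-≗ (λ t → ℕ.*-assoc k (lookup (𝐞 i) t) (f t)) ⟩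
  Σℕ (λ t → k ℕ.* (lookup (𝐞 i) t ℕ.* f t))  ≡⟨ ℕSum.*-distribˡ-sum k (λ t → lookup (𝐞 i) t ℕ.* f t) ⟨
  k ℕ.* Σℕ (λ t → lookup (𝐞 i) t ℕ.* f t)    ≡⟨ cong (k ℕ.*_) (Σ-𝐞 i f) ⟩
  k ℕ.* f i                                  ∎
  where open ≡.≡-Reasoning

-- For `k = pred r` and `i ≢ j` the weights describe the diagonal matrix with `ζ` at `i` and its
-- inverse at `j`. Adding the two unit vectors avoids separating the case `i ≡ j`.
Σ-𝐞+*𝐞 : ∀ {n} k (i j : Fin n) (f : Fin n → ℕ) →
  Σℕ (λ t → (lookup (𝐞 i) t ℕ.+ k ℕ.* lookup (𝐞 j) t) ℕ.* f t) ≡ f i ℕ.+ k ℕ.* f j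
Σ-𝐞+*𝐞 k i j f = begin
  Σℕ (λ t → (lookup (𝐞 i) t ℕ.+ k ℕ.* lookup (𝐞 j) t) ℕ.* f t)
    ≡⟨ ℕSum.sum-cong-≗ (λ t → ℕ.*-distribʳ-+ (f t) (lookup (𝐞 i) t) _) ⟩
  Σℕ (λ t → lookup (𝐞 i) t ℕ.* f t ℕ.+ (k ℕ.* lookup (𝐞 j) t) ℕ.* f t)
    ≡⟨ ℕSum.∑-distrib-+ (λ t → lookup (𝐞 i) t ℕ.* f t) (λ t → (k ℕ.* lookup (𝐞 j) t) ℕ.* f t) ⟩
  Σℕ (λ t → lookup (𝐞 i) t ℕ.* f t) ℕ.+ Σℕ (λ t → (k ℕ.* lookup (𝐞 j) t) ℕ.* f t)
    ≡⟨ cong₂ ℕ._+_ (Σ-𝐞 i f) (Σ-*𝐞 k j f) ⟩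
  f i ℕ.+ k ℕ.* f j ∎
  where open ≡.≡-Reasoning

-- Lets the formulas for weighted sums, taken at the constant 1, also compute the total exponent
-- that governs membership in G(r,p,n).
Σ-*1 : ∀ {n} (e : Fin n → ℕ) → Σℕ e ≡ Σℕ (λ t → e t ℕ.* 1)
Σ-*1 e = ℕSum.sum-cong-≗ (λ t → ≡.sym (ℕ.*-identityʳ (e t)))

-- Roots of unity and the group G(r,p,n)

module Group {c ℓ₁ ℓ₂ : Level} (K : HeytingField c ℓ₁ ℓ₂) where

  open Polynomials K
  open HeytingField K using (_#_; #⇒invertible; #-irrefl)
  open import Algebra.Apartness.Properties.HeytingCommutativeRing
    (HeytingField.heytingCommutativeRing K) using (1#0; #-congʳ)
  open CommutativeRing commutativeRing hiding (zero) renaming (refl to ≈-refl)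
  open import Algebra.Properties.CommutativeSemiring.Exp commutativeSemiring
  open import Algebra.Properties.CommutativeMonoid.Sum *-commutativeMonoid
    using () renaming (sum to ∏; sum-cong-≋ to ∏-cong; ∑-distrib-+ to ∏-distrib-*)
  open import Relation.Binary.Reasoning.Setoid setoid

  1^ : ∀ k → 1# ^ k ≈ 1#
  1^ zero    = ≈-refl
  1^ (suc k) = trans (*-identityˡ _) (1^ k)

  ^-root : ∀ v r → v ^ r ≈ 1# → ∀ k → v ^ (r ℕ.* k) ≈ 1#
  ^-root v r v^r≈1 k = trans (sym (^-assocʳ v r k)) (trans (^-congˡ k v^r≈1) (1^ k))

  ^-% : ∀ {v r} .{{_ : NonZero r}} → v ^ r ≈ 1# → ∀ k → v ^ k ≈ v ^ (k % r)
  ^-% {v} {r} v^r≈1 k = begin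
    v ^ k                              ≈⟨ ^-congʳ v (m≡m%n+[m/n]*n k r) ⟩
    v ^ (k % r ℕ.+ k / r ℕ.* r)        ≈⟨ ^-homo-* v (k % r) (k / r ℕ.* r) ⟩
    v ^ (k % r) * v ^ (k / r ℕ.* r)
      ≈⟨ *-congˡ (trans (^-congʳ v (ℕ.*-comm (k / r) r)) (^-root v r v^r≈1 (k / r))) ⟩
    v ^ (k % r) * 1#                   ≈⟨ *-identityʳ _ ⟩
    v ^ (k % r)                        ∎

  root≉0 : ∀ {v r} .{{_ : NonZero r}} → v ^ r ≈ 1# → ¬ (v ≈ 0#)
  root≉0 {v} {suc r} v^r≈1 v≈0 =
    #-irrefl (trans (sym v^r≈1) (trans (*-congʳ v≈0) (zeroˡ _))) 1#0

  ∏-1 : ∀ {n} (f : Fin n → Carrier) → (∀ i → f i ≈ 1#) → ∏ f ≈ 1#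
  ∏-1 = SingleTerm.sum-zero *-commutativeMonoid

  ∏-^ : ∀ {n} (v : Fin n → Carrier) k → ∏ (λ i → v i ^ k) ≈ ∏ v ^ k
  ∏-^ {zero}  v k = sym (1^ k)
  ∏-^ {suc n} v k = trans (*-congˡ (∏-^ (v ∘ suc) k)) (sym (^-distrib-* (v zero) _ k))

  ∏-^-Σ : ∀ {n} x (e : Fin n → ℕ) → ∏ (λ i → x ^ e i) ≈ x ^ Σℕ e
  ∏-^-Σ {zero}  x e = ≈-refl
  ∏-^-Σ {suc n} x e = trans (*-congˡ (∏-^-Σ x (e ∘ suc))) (sym (^-homo-* x (e zero) _))

  degree : ∀ {n} → Mon n → Fin n → ℕ
  degree (α , β) t = lookup α t ℕ.+ lookup β t

  character-∏ : ∀ {n} (v : Fin n → Carrier) m → character v m ≈ ∏ (λ t → v t ^ degree m t)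
  character-∏ v (α , β) = sym (trans
    (∏-cong λ t → ^-homo-* (v t) (lookup α t) (lookup β t))
    (∏-distrib-* (λ t → v t ^ lookup α t) (λ t → v t ^ lookup β t)))

  -- Monomial matrices

  record MonomialMatrix (r p : ℕ) .{{_ : NonZero p}} {n} (A : Matrix K n) : Set (c ⊔ ℓ₁) where
    field
      σ τ  : Fin n → Fin n
      τσ   : ∀ i → τ (σ i) ≡ i
      στ   : ∀ i → σ (τ i) ≡ i
      supp : Supported A σ
      root : ∀ i → A i (σ i) ^ r ≈ 1#
      norm : ∏ (λ i → A i (σ i)) ^ (r / p) ≈ 1#

  -- det A = ε ∏ᵢ A i (σ i) and det ∣A∣ = ε with ε = ± 1, so that det A / det ∣A∣ = ∏ᵢ A i (σ i)
  InGrpn⇒MonomialMatrix : ∀ {r p n} .{{_ : NonZero r}} .{{_ : NonZero p}} {A : Matrix K n} →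
    InGrpn K r p n A → MonomialMatrix r p A
  InGrpn⇒MonomialMatrix {r} {p} {n} {A} g = record
    { σ = σ ; τ = τ ; τσ = τσ ; στ = στ
    ; supp = λ i → proj₂ (proj₂ (row i))
    ; root = λ i → proj₁ (proj₂ (row i))
    ; norm = trans (^-congˡ (r / p) ∏≈ω) ω-root
    }
    where
    open InGrpn g
    σ τ : Fin n → Fin n
    σ i = proj₁ (row i)
    τ j = proj₁ (col j)
    -- Rows and columns name their nonzero entries independently. The entry at `(τ j , j)` is a root
    -- of unity, hence not 0, so it cannot lie off the support of its row.
    στ : ∀ j → σ (τ j) ≡ j
    στ j with j Fin.≟ σ (τ j)
    ... | yes eq = ≡.sym eq
    ... | no j≢  = contradiction (proj₂ (proj₂ (row (τ j))) j j≢) (root≉0 (proj₁ (proj₂ (col j))))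
    τσ : ∀ i → τ (σ i) ≡ i
    τσ i with i Fin.≟ τ (σ i)
    ... | yes eq = ≡.sym eq
    ... | no i≢  = contradiction (proj₂ (proj₂ (col (σ i))) i i≢) (root≉0 (proj₁ (proj₂ (row i))))
    σ-injective : ∀ {i j} → σ i ≡ σ j → i ≡ j
    σ-injective {i} {j} eq = ≡.trans (≡.sym (τσ i)) (≡.trans (cong τ eq) (τσ j))
    ω = proj₁ detRatio
    ω-root = proj₁ (proj₂ detRatio)
    sign = det-monomial n σ σ-injective
    ε = proj₁ sign
    ε²≈1 = proj₁ (proj₂ sign)
    det≈ = proj₂ (proj₂ sign)
    ∏≈ω : ∏ (λ i → A i (σ i)) ≈ ω
    ∏≈ω = begin
      ∏ (λ i → A i (σ i))                 ≈⟨ *-identityˡ _ ⟨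
      1# * ∏ (λ i → A i (σ i))            ≈⟨ *-congʳ ε²≈1 ⟨
      ε * ε * ∏ (λ i → A i (σ i))         ≈⟨ *-assoc _ _ _ ⟩
      ε * (ε * ∏ (λ i → A i (σ i)))       ≈⟨ *-congˡ (det≈ A (λ i j → proj₂ (proj₂ (row i)) j)) ⟨
      ε * det K A                         ≈⟨ *-congˡ (proj₂ (proj₂ detRatio)) ⟩
      ε * (ω * det K ∣A∣)                 ≈⟨ *-congˡ (*-congˡ (det≈ ∣A∣ λ i j → if-no (j Fin.≟ σ i))) ⟩
      ε * (ω * (ε * ∏ (λ i → ∣A∣ i (σ i))))
        ≈⟨ *-congˡ (*-congˡ (trans
             (*-congˡ (∏-1 _ λ i → if-yes (σ i Fin.≟ σ i) refl)) (*-identityʳ ε))) ⟩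
      ε * (ω * ε)                         ≈⟨ *-congˡ (*-comm ω ε) ⟩
      ε * (ε * ω)                         ≈⟨ *-assoc _ _ _ ⟨
      ε * ε * ω                           ≈⟨ *-congʳ ε²≈1 ⟩
      1# * ω                              ≈⟨ *-identityˡ ω ⟩
      ω                                   ∎

  module _ {n} (π : Permutation′ n) (v : Fin n → Carrier) where

    permutationMatrix : Matrix K n
    permutationMatrix i j = if does (j Fin.≟ π ⟨$⟩ʳ i) then v i else 0#

    permutationMatrix-entry : ∀ i → permutationMatrix i (π ⟨$⟩ʳ i) ≈ v i
    permutationMatrix-entry i = if-yes (π ⟨$⟩ʳ i Fin.≟ π ⟨$⟩ʳ i) refl

    permutationMatrix-supported : Supported permutationMatrix (π ⟨$⟩ʳ_)
    permutationMatrix-supported i j = if-no (j Fin.≟ π ⟨$⟩ʳ i)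

    -- The determinant ratio is `∏ v`, because the sign `ε` is common to the matrix and its absolute
    -- value, whose nonzero entries are 1.
    permutationMatrix∈Grpn : ∀ r p .{{_ : NonZero p}} → (∀ i → v i ^ r ≈ 1#) → ∏ v ^ (r / p) ≈ 1# →
      InGrpn K r p n permutationMatrix
    permutationMatrix∈Grpn r p root norm = record
      { inG      = inG
      ; detRatio = ∏ v , norm , (begin
          det K permutationMatrix                          ≈⟨ det≈ _ permutationMatrix-supported ⟩
          ε * ∏ (λ i → permutationMatrix i (π ⟨$⟩ʳ i))     ≈⟨ *-congˡ (∏-cong permutationMatrix-entry) ⟩
          ε * ∏ v                                          ≈⟨ *-comm ε _ ⟩
          ∏ v * ε                                          ≈⟨ *-congˡ (*-identityʳ ε) ⟨
          ∏ v * (ε * 1#)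
            ≈⟨ *-congˡ (*-congˡ (∏-1 _ λ i → if-yes (π ⟨$⟩ʳ i Fin.≟ π ⟨$⟩ʳ i) refl)) ⟨
          ∏ v * (ε * ∏ (λ i → InGrn.∣A∣ inG i (π ⟨$⟩ʳ i)))
            ≈⟨ *-congˡ (det≈ (InGrn.∣A∣ inG) (λ i j → if-no (j Fin.≟ π ⟨$⟩ʳ i))) ⟨
          ∏ v * det K (InGrn.∣A∣ inG)                      ∎)
      }
      where
      entry-root : ∀ {i j} → j ≡ π ⟨$⟩ʳ i → permutationMatrix i j ^ r ≈ 1#
      entry-root {i} refl = trans (^-congˡ r (permutationMatrix-entry i)) (root i)
      inG : InGrn K r n permutationMatrix
      inG = record
        { row = λ i → π ⟨$⟩ʳ i , entry-root refl , permutationMatrix-supported i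
        ; col = λ j → π ⟨$⟩ˡ j , entry-root (≡.sym (Perm.inverseʳ π)) ,
            λ i i≢ → permutationMatrix-supported i j λ { refl → i≢ (≡.sym (Perm.inverseˡ π)) }
        }
      sign = det-monomial n (π ⟨$⟩ʳ_) λ {i} {j} eq →
        ≡.trans (≡.sym (Perm.inverseˡ π)) (≡.trans (cong (π ⟨$⟩ˡ_) eq) (Perm.inverseˡ π))
      ε = proj₁ sign
      det≈ = proj₂ (proj₂ sign)

  -- Coefficients of invariant polynomials

  character-cong : ∀ {n} {v w : Fin n → Carrier} → (∀ i → v i ≈ w i) →
    ∀ m → character v m ≈ character w m
  character-cong v≈w (α , β) = *-cong
    (∏-cong λ i → ^-congˡ (lookup α i) (v≈w i)) (∏-cong λ i → ^-congˡ (lookup β i) (v≈w i))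

  -- The second component of `Invariants` with the carrier of `QuotientG` unfolded: invariance is
  -- tested on representatives, where `s` does not occur.
  Invariant : ∀ (r p n : ℕ) .{{_ : NonZero p}} → Poly K n → Set (c ⊔ ℓ₁ ⊔ ℓ₂)
  Invariant r p n f = ∀ (g : Σ (Matrix K n) (InGrpn K r p n)) → _≈ₚ_ K (act K (proj₁ g) f) f

  module _ {r p n} .{{_ : NonZero r}} .{{_ : NonZero p}}
           (f : Poly K n) (f-inv : Invariant r p n f) where

    -- Used at two extremes: all `v i` equal to 1 gives constancy on orbits of the symmetric group,
    -- and `π` the identity gives the conditions on exponents.
    invariant-coeff : ∀ π v → (∀ i → v i ^ r ≈ 1#) → ∏ v ^ (r / p) ≈ 1# → ∀ m →
      coeff K f m ≈ character v (m ∘ₘ (π ⟨$⟩ʳ_)) * coeff K f (m ∘ₘ (π ⟨$⟩ʳ_))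
    invariant-coeff π v root norm m = begin
      coeff K f m
        ≈⟨ f-inv (permutationMatrix π v , permutationMatrix∈Grpn π v r p root norm) m ⟨
      coeff K (act K (permutationMatrix π v) f) m
        ≈⟨ coeff-act (permutationMatrix-supported π v)
             (λ i → Perm.inverseˡ π) (λ i → Perm.inverseʳ π) f m ⟩
      character (λ i → permutationMatrix π v i (π ⟨$⟩ʳ i)) (m ∘ₘ (π ⟨$⟩ʳ_)) * coeff K f (m ∘ₘ (π ⟨$⟩ʳ_))
        ≈⟨ *-congʳ (character-cong (permutationMatrix-entry π v) (m ∘ₘ (π ⟨$⟩ʳ_))) ⟩
      character v (m ∘ₘ (π ⟨$⟩ʳ_)) * coeff K f (m ∘ₘ (π ⟨$⟩ʳ_)) ∎

    coeff-↭ : ∀ m m′ → cells m ↭ cells m′ → coeff K f m ≈ coeff K f m′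
    coeff-↭ m m′ m↭m′ with π , m≡m′π ← ↭-tabulate⇒permutation (cell m) (cell m′) m↭m′ = sym (begin
      coeff K f m′
        ≈⟨ invariant-coeff π (λ _ → 1#) (λ _ → 1^ r)
             (trans (^-congˡ (r / p) (∏-1 {n} (λ _ → 1#) λ _ → ≈-refl)) (1^ (r / p))) m′ ⟩
      character (λ _ → 1#) (m′ ∘ₘ (π ⟨$⟩ʳ_)) * coeff K f (m′ ∘ₘ (π ⟨$⟩ʳ_))
        ≈⟨ *-cong (trans (character-∏ _ (m′ ∘ₘ (π ⟨$⟩ʳ_)))
                         (∏-1 {n} _ λ t → 1^ (degree (m′ ∘ₘ (π ⟨$⟩ʳ_)) t)))
                  (reflexive (cong (coeff K f) (≡.sym m≡))) ⟩
      1# * coeff K f m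
        ≈⟨ *-identityˡ _ ⟩
      coeff K f m ∎)
      where
      m≡ : m ≡ m′ ∘ₘ (π ⟨$⟩ʳ_)
      m≡ = cong₂ _,_
        (lookup-injective λ i → ≡.trans (cong proj₁ (m≡m′π i)) (≡.sym (Vec.lookup∘tabulate _ i)))
        (lookup-injective λ i → ≡.trans (cong proj₂ (m≡m′π i)) (≡.sym (Vec.lookup∘tabulate _ i)))

    -- Apartness of `y` from 1 provides an inverse of `y - 1#`, which annihilates `x`.
    x≈yx⇒x≈0 : ∀ {x y} → y # 1# → x ≈ y * x → x ≈ 0#
    x≈yx⇒x≈0 {x} {y} y#1 x≈yx with z , z[y-1]≈1 , _ ← #⇒invertible y#1 = begin
      x                       ≈⟨ *-identityˡ x ⟨
      1# * x                  ≈⟨ *-congʳ z[y-1]≈1 ⟨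
      z * (y - 1#) * x        ≈⟨ *-assoc z _ x ⟩
      z * ((y - 1#) * x)      ≈⟨ *-congˡ (distribʳ x y (- 1#)) ⟩
      z * (y * x + - 1# * x)
        ≈⟨ *-congˡ (+-cong (sym x≈yx) (trans (sym (-‿distribˡ-* 1# x)) (-‿cong (*-identityˡ x)))) ⟩
      z * (x - x)             ≈⟨ *-congˡ (-‿inverseʳ x) ⟩
      z * 0#                  ≈⟨ zeroʳ z ⟩
      0#                      ∎
      where open import Algebra.Properties.Ring ring using (-‿distribˡ-*)

    module _ (p∣r : p ∣ r) {ζ} (ζ-prim : IsPrimitiveRoot K r ζ) where

      open IsPrimitiveRoot ζ-prim

      ζ^-apart : ∀ k → k % r ≢ 0 → ζ ^ k # 1#
      ζ^-apart k k%r≢0 =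
        #-congʳ (sym (^-% root k)) (apart (k % r) (ℕ.n≢0⇒n>0 k%r≢0) (m%n<n k r))

      -- ζ ^ Σ e t (degree m t) is the eigenvalue of diag(ζ ^ e t) on the monomial m
      diagonal-weight : ∀ (e : Fin n → ℕ) → p ∣ Σℕ e → ∀ m →
        Σℕ (λ t → e t ℕ.* degree m t) % r ≢ 0 → coeff K f m ≈ 0#
      diagonal-weight e (divides k Σe≡kp) m nontrivial = x≈yx⇒x≈0
        (ζ^-apart _ nontrivial) (begin
          coeff K f m
            ≈⟨ invariant-coeff Perm.id (λ t → ζ ^ e t) e-root e-norm m ⟩
          character (λ t → ζ ^ e t) (m ∘ₘ id) * coeff K f (m ∘ₘ id)
            ≈⟨ reflexive (cong (λ m → character (λ t → ζ ^ e t) m * coeff K f m) m∘id≡m) ⟩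
          character (λ t → ζ ^ e t) m * coeff K f m
            ≈⟨ *-congʳ eigenvalue ⟩
          ζ ^ Σℕ (λ t → e t ℕ.* degree m t) * coeff K f m ∎)
        where
        m∘id≡m : m ∘ₘ id ≡ m
        m∘id≡m = cong₂ _,_ (Vec.tabulate∘lookup (proj₁ m)) (Vec.tabulate∘lookup (proj₂ m))
        e-root : ∀ t → (ζ ^ e t) ^ r ≈ 1#
        e-root t = trans (^-assocʳ ζ (e t) r)
          (trans (^-congʳ ζ (ℕ.*-comm (e t) r)) (^-root ζ r root (e t)))
        e-norm : ∏ (λ t → ζ ^ e t) ^ (r / p) ≈ 1#
        e-norm = begin
          ∏ (λ t → ζ ^ e t) ^ (r / p)   ≈⟨ ^-congˡ (r / p) (∏-^-Σ ζ e) ⟩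
          (ζ ^ Σℕ e) ^ (r / p)          ≈⟨ ^-assocʳ ζ (Σℕ e) (r / p) ⟩
          ζ ^ (Σℕ e ℕ.* (r / p))        ≈⟨ ^-congʳ ζ exponent ⟩
          ζ ^ (r ℕ.* k)                 ≈⟨ ^-root ζ r root k ⟩
          1#                            ∎
          where
          exponent : Σℕ e ℕ.* (r / p) ≡ r ℕ.* k
          exponent = ≡.trans (cong (ℕ._* (r / p)) Σe≡kp) (≡.trans (ℕ.*-assoc k p (r / p))
            (≡.trans (cong (k ℕ.*_) (≡.trans (ℕ.*-comm p (r / p)) (m/n*n≡m p∣r))) (ℕ.*-comm k r)))
        eigenvalue : character (λ t → ζ ^ e t) m ≈ ζ ^ Σℕ (λ t → e t ℕ.* degree m t)
        eigenvalue = trans (character-∏ _ m) (trans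
          (∏-cong λ t → ^-assocʳ ζ (e t) (degree m t)) (∏-^-Σ ζ (λ t → e t ℕ.* degree m t)))

  Good : ∀ (r p : ℕ) .{{_ : NonZero r}} .{{_ : NonZero p}} {n} → Mon n → Set
  Good r p m = ∃[ l ] l < p × ∀ t → Residue r p l (cell m t)

  module _ {r p} .{{_ : NonZero r}} .{{_ : NonZero p}} (p∣r : p ∣ r) where

    -- Two kinds of diagonal matrices detect a bad monomial. `ζ ^ p` in the first position forces
    -- `p * degree m zero` to be 0 modulo `r`, which yields `l`. Then some `i` violates the
    -- congruence for this `l`, found by a finite search, and `ζ` at `i` with `ζ ^ pred r` in the
    -- first position has an eigenvalue with exponent `degree m i - degree m zero` modulo `r`. The
    -- total exponents `p` and `r` are multiples of `p`, so both matrices lie in G(r,p,n).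
    coeff-bad : ∀ {ζ} → IsPrimitiveRoot K r ζ → ∀ {n} (f : Poly K (suc n)) →
      Invariant r p (suc n) f → ∀ m → ¬ Good r p m → coeff K f m ≈ 0#
    coeff-bad ζ-prim {n} f f-inv m bad with (p ℕ.* degree m zero) % r ℕ.≟ 0
    ... | no ≢0 = diagonal-weight f f-inv p∣r ζ-prim (λ t → p ℕ.* lookup (𝐞 zero) t)
      (subst (p ∣_) (≡.sym (≡.trans (Σ-*1 e) (Σ-*𝐞 {suc n} p zero (λ _ → 1)))) (m∣m*n 1)) m
      (subst (λ k → k % r ≢ 0) (≡.sym (Σ-*𝐞 p zero (degree m))) ≢0)
      where
      e : Fin (suc n) → ℕ
      e t = p ℕ.* lookup (𝐞 zero) t
    ... | yes ≡0 with l , l<p , degree₀≡ ← residue-exists p∣r (degree m zero) (m%n≡0⇒n∣m _ r ≡0)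
                 with Fin.¬∀⟶∃¬ (suc n) _ (λ t → degree m t % r ℕ.≟ (l ℕ.* (r / p)) % r)
                        (λ good → bad (l , l<p , good))
    ...   | i , degreeᵢ≢ = diagonal-weight f f-inv p∣r ζ-prim e
      (subst (p ∣_) (≡.sym (≡.trans (Σ-*1 e) (≡.trans (Σ-𝐞+*𝐞 (pred r) i zero (λ _ → 1))
        (≡.trans (cong (1 ℕ.+_) (ℕ.*-identityʳ (pred r))) (ℕ.suc-pred r))))) p∣r) m
      (λ eq → degreeᵢ≢ (≡.trans
        (opposite-residue (degree m i) (degree m zero)
          (≡.trans (cong (_% r) (≡.sym (Σ-𝐞+*𝐞 (pred r) i zero (degree m)))) eq))
        degree₀≡))
      where
      e : Fin (suc n) → ℕ
      e t = lookup (𝐞 i) t ℕ.+ pred r ℕ.* lookup (𝐞 zero) t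

    -- As the entries are r-th roots of unity, every exponent may be replaced by the common
    -- `l * (r / p)`. What remains is a power of `∏ v ^ (r / p)`, which is 1 by `norm`.
    character-good : ∀ {n} {A : Matrix K n} (M : MonomialMatrix r p A) {m} → Good r p m →
      character (λ i → A i (MonomialMatrix.σ M i)) m ≈ 1#
    character-good {A = A} M {m} (l , _ , residue) = begin
      character v m                            ≈⟨ character-∏ v m ⟩
      ∏ (λ t → v t ^ degree m t)               ≈⟨ ∏-cong (λ t → ^-% (root t) (degree m t)) ⟩
      ∏ (λ t → v t ^ (degree m t % r))         ≈⟨ ∏-cong (λ t → ^-congʳ (v t) (residue t)) ⟩
      ∏ (λ t → v t ^ ((l ℕ.* (r / p)) % r))    ≈⟨ ∏-cong (λ t → ^-% (root t) (l ℕ.* (r / p))) ⟨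
      ∏ (λ t → v t ^ (l ℕ.* (r / p)))          ≈⟨ ∏-^ v (l ℕ.* (r / p)) ⟩
      ∏ v ^ (l ℕ.* (r / p))                    ≈⟨ ^-congʳ (∏ v) (ℕ.*-comm l (r / p)) ⟩
      ∏ v ^ (r / p ℕ.* l)                      ≈⟨ ^-root (∏ v) (r / p) norm l ⟩
      1#                                       ∎
      where
      open MonomialMatrix M
      v = λ i → A i (σ i)

-- A finite list containing every monomial of a given bidegree

vectors : ∀ n → ℕ → List (Vec ℕ n)
vectors zero    k = Vec.[] ∷ []
vectors (suc n) k = cartesianProductWith Vec._∷_ (upTo (suc k)) (vectors n k)

-- Each entry is bounded by `k` separately, so `vectors` also lists vectors of larger sum; filtering
-- by class removes them from the orbit sums.
∈-vectors : ∀ {n k} (α : Vec ℕ n) → Vec.sum α ≤ k → α ∈ vectors n k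
∈-vectors Vec.[]      _ = here refl
∈-vectors (a Vec.∷ α) le = ∈-cartesianProductWith⁺ Vec._∷_
  (∈-upTo⁺ (s≤s (ℕ.≤-trans (ℕ.m≤m+n a _) le))) (∈-vectors α (ℕ.≤-trans (ℕ.m≤n+m _ a) le))

vectors-unique : ∀ n k → Unique (vectors n k)
vectors-unique zero    k = [] ∷ []
vectors-unique (suc n) k =
  Unique.cartesianProductWith⁺ Vec._∷_ Vec.∷-injective (Unique.upTo⁺ (suc k)) (vectors-unique n k)

monomials : ∀ n → ℕ → ℕ → List (Mon n)
monomials n a b = cartesianProduct (vectors n a) (vectors n b)

cells-permute : ∀ {n} {σ τ : Fin n → Fin n} → (∀ i → τ (σ i) ≡ i) → (∀ i → σ (τ i) ≡ i) →
  ∀ m → cells (m ∘ₘ σ) ↭ cells m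
cells-permute {σ = σ} {τ} τσ στ m = ↭-trans
  (↭-reflexive (List.tabulate-cong λ t → cong₂ _,_ (Vec.lookup∘tabulate _ t) (Vec.lookup∘tabulate _ t)))
  (tabulate-permute (cell m) (Perm.permutation σ τ στ τσ))

module Dimension {c ℓ₁ ℓ₂ : Level} (K : HeytingField c ℓ₁ ℓ₂) where

  open Polynomials K
  open Group K
  open CommutativeRing commutativeRing hiding (zero) renaming (refl to ≈-refl)
  open import Algebra.Properties.CommutativeMonoid.Sum +-commutativeMonoid using (sum; sum-cong-≋)
  open SingleTerm +-commutativeMonoid
  open import Relation.Binary.Reasoning.Setoid setoid

  -- Orbit sums

  ΣMon : ∀ {n} → List (Mon n) → Poly K n
  ΣMon = map (1# ,_)

  coeff-ΣMon-∉ : ∀ {n} (L : List (Mon n)) m → m ∉ L → coeff K (ΣMon L) m ≈ 0#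
  coeff-ΣMon-∉ []      m _   = ≈-refl
  coeff-ΣMon-∉ (μ ∷ L) m m∉ = trans
    (+-cong (δ-≢ μ m λ eq → m∉ (here (≡.sym eq))) (coeff-ΣMon-∉ L m (m∉ ∘ there)))
    (+-identityʳ 0#)

  coeff-ΣMon-∈ : ∀ {n} {L : List (Mon n)} {m} → Unique L → m ∈ L → coeff K (ΣMon L) m ≈ 1#
  coeff-ΣMon-∈ {L = μ ∷ L} (μ∉L ∷ _) (here refl) = trans
    (+-cong (δ-≡ μ) (coeff-ΣMon-∉ L μ λ μ∈L → All.lookup μ∉L μ∈L refl)) (+-identityʳ 1#)
  coeff-ΣMon-∈ {L = μ ∷ L} {m} (μ∉L ∷ unique) (there m∈L) = trans
    (+-cong (δ-≢ μ m (All.lookup μ∉L m∈L)) (coeff-ΣMon-∈ unique m∈L)) (+-identityˡ 1#)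

  ΣMon∈S : ∀ {n s} {L : List (Mon n)} → All (Divisible s) L → S[X,Y] K s (ΣMon L)
  -- No constructor of `S[X,Y]` yields the empty list, so zero is reached as `0#` times one.
  ΣMon∈S []                = resp (λ m → trans (coeff-• 0# (1ₚ K) m) (zeroˡ _)) (scale 0# one)
  ΣMon∈S ((p , q) ∷ divs) = plus (gen _ p q) (ΣMon∈S divs)

  -- Dimensions of the bihomogeneous components

  module _ {r p s : ℕ} .{{_ : NonZero r}} .{{_ : NonZero p}} .{{_ : NonZero s}}
           (s∣r : s ∣ r) (p∣r : p ∣ r) {ζ} (ζ-prim : IsPrimitiveRoot K r ζ) where

    V : ∀ n a b → Poly K n → Set (c ⊔ ℓ₁ ⊔ ℓ₂)
    V n a b f = Invariants K r p s n s∣r ζ-prim f × Bidegree K a b f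

    bidegree? : ∀ {n} a b (m : Mon n) → Dec (degˣ m ≡ a × degʸ m ≡ b)
    bidegree? a b m = (degˣ m ℕ.≟ a) ×-dec (degʸ m ℕ.≟ b)

    dimension-∤ : ∀ {n a b} → ¬ (s ∣ a) → HasDimension K (V n a b) 0
    dimension-∤ {a = a} {b} s∤a = record
      { basis = λ () ; inV = λ () ; independent = λ _ _ () ; spanning = λ f f∈V → (λ ()) , zero≈ f f∈V }
      where
      zero≈ : ∀ f → V _ a b f → _≈ₚ_ K [] f
      zero≈ f ((f∈S , _) , bidegree) m with bidegree? a b m
      ... | yes (da , _) = sym (S-coeff f∈S m (s∤a ∘ subst (s ∣_) da ∘ proj₁))
      ... | no ¬ab       = sym (bidegree m ¬ab)

    P : ∀ n a b → List Cell → Set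
    P n a b xs = (∃[ l ] l < p × All (Residue r p l) xs) × Weight n a b xs

    P? : ∀ n a b → Decidable (P n a b)
    P? n a b xs = ℕ.anyUpTo? (λ l → All.all? (Residue? r p l) xs) p ×-dec Weight? n a b xs

    P-↭ : ∀ {n a b xs ys} → xs ↭ ys → P n a b xs → P n a b ys
    P-↭ xs↭ys ((l , l<p , res) , w) = (l , l<p , All-resp-↭ xs↭ys res) , Weight-↭ xs↭ys w

    module _ {n} (d∣n : d⟨ r , p , s ⟩ ∣ suc n) {a b} (s∣a : s ∣ a)
             {D} (classes : Classes (P (suc n) a b) (Fin D)) where

      open Classes classes

      P⇒Good : ∀ (m : Mon (suc n)) → P (suc n) a b (cells m) → Good r p m
      P⇒Good m ((l , l<p , res) , _) = l , l<p , All.tabulate⁻ {f = cell m} res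

      Good⇒P : ∀ (m : Mon (suc n)) → degˣ m ≡ a → degʸ m ≡ b → Good r p m → P (suc n) a b (cells m)
      Good⇒P m da db (l , l<p , res) =
        (l , l<p , All.tabulate⁺ {f = cell m} res) , bidegree⇒Weight m da db

      InClass : Fin D → Mon (suc n) → Set
      InClass i m = cells m ↭ rep i

      InClass⇒P : ∀ {i m} → InClass i m → P (suc n) a b (cells m)
      InClass⇒P {i} m↭ = P-↭ (↭-sym m↭) (rep∈ i)

      InClass-unique : ∀ {i j m} → InClass i m → InClass j m → i ≡ j
      InClass-unique m↭ m↭′ = distinct _ _ (↭-trans (↭-sym m↭) m↭′)

      -- Instead of deciding `↭`, the decidable `P` is tested; if it holds, `index` names the class
      -- of `m`, and it remains to compare two elements of `Fin D`.
      InClass? : ∀ i m → Dec (InClass i m)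
      InClass? i m with P? (suc n) a b (cells m)
      ... | no ¬P = no (¬P ∘ InClass⇒P {i} {m})
      ... | yes Pm with index Pm
      ...   | j , m↭ with j Fin.≟ i
      ...     | yes refl = yes m↭
      ...     | no j≢i   = no λ m↭′ → j≢i (InClass-unique {m = m} m↭ m↭′)

      -- The sum runs over the distinct monomials of the orbit, not over group elements, so each
      -- coefficient is 1 whatever the stabiliser.
      orbitSum : Fin D → Poly K (suc n)
      orbitSum i = ΣMon (filter (InClass? i) (monomials (suc n) a b))

      coeff-orbitSum-∈ : ∀ i m → InClass i m → coeff K (orbitSum i) m ≈ 1#
      coeff-orbitSum-∈ i m@(α , β) m↭ with Weight⇒bidegree m (proj₂ (InClass⇒P {i} {m} m↭))
      ... | da , db = coeff-ΣMon-∈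
        (Unique.filter⁺ (InClass? i)
          (Unique.cartesianProduct⁺ (vectors-unique _ a) (vectors-unique _ b)))
        (∈-filter⁺ (InClass? i)
          (∈-cartesianProduct⁺ (∈-vectors α (ℕ.≤-reflexive da)) (∈-vectors β (ℕ.≤-reflexive db))) m↭)

      coeff-orbitSum-∉ : ∀ i m → ¬ InClass i m → coeff K (orbitSum i) m ≈ 0#
      coeff-orbitSum-∉ i m m∉ = coeff-ΣMon-∉ _ m
        λ m∈ → m∉ (proj₂ (∈-filter⁻ (InClass? i) {xs = monomials (suc n) a b} m∈))

      orbitSum∈V : ∀ i → V (suc n) a b (orbitSum i)
      orbitSum∈V i = (ΣMon∈S divisibles , invariant) , bidegree
        where
        divisible : ∀ m → InClass i m → Divisible s m
        divisible m m↭ with InClass⇒P {i} {m} m↭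
        ... | (l , _ , res) , w with Weight⇒bidegree m w
        ...   | da , db = subst (s ∣_) (≡.sym da) s∣a ,
          subst (s ∣_) (≡.sym db) (Weight-divisible p∣r s s∣r l d∣n res w s∣a)
        divisibles = All.map (λ {m} → divisible m)
          (All.all-filter (InClass? i) (monomials (suc n) a b))
        bidegree : Bidegree K a b (orbitSum i)
        bidegree m ¬ab = coeff-orbitSum-∉ i m
          λ m↭ → ¬ab (Weight⇒bidegree m (proj₂ (InClass⇒P {i} {m} m↭)))
        invariant : Invariant r p (suc n) (orbitSum i)
        invariant (A , A∈G) m = trans
          (coeff-act supp τσ στ (orbitSum i) m) (transported (InClass? i (m ∘ₘ σ)))
          where
          M = InGrpn⇒MonomialMatrix A∈G
          open MonomialMatrix M
          mσ↭m = cells-permute {σ = σ} {τ} τσ στ m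
          -- `m` and `m ∘ₘ σ` lie in the same class or both outside it; the character matters only
          -- inside, where it is 1.
          transported : Dec (InClass i (m ∘ₘ σ)) →
            character (λ t → A t (σ t)) (m ∘ₘ σ) * coeff K (orbitSum i) (m ∘ₘ σ) ≈
            coeff K (orbitSum i) m
          transported (yes mσ∈) = begin
            character (λ t → A t (σ t)) (m ∘ₘ σ) * coeff K (orbitSum i) (m ∘ₘ σ)
              ≈⟨ *-cong (character-good p∣r M {m ∘ₘ σ} (P⇒Good (m ∘ₘ σ) (InClass⇒P {i} {m ∘ₘ σ} mσ∈)))
                        (coeff-orbitSum-∈ i (m ∘ₘ σ) mσ∈) ⟩
            1# * 1#
              ≈⟨ *-identityˡ 1# ⟩
            1#
              ≈⟨ coeff-orbitSum-∈ i m (↭-trans (↭-sym mσ↭m) mσ∈) ⟨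
            coeff K (orbitSum i) m ∎
          transported (no mσ∉) = begin
            character (λ t → A t (σ t)) (m ∘ₘ σ) * coeff K (orbitSum i) (m ∘ₘ σ)
              ≈⟨ *-congˡ (coeff-orbitSum-∉ i (m ∘ₘ σ) mσ∉) ⟩
            character (λ t → A t (σ t)) (m ∘ₘ σ) * 0#
              ≈⟨ zeroʳ _ ⟩
            0#
              ≈⟨ coeff-orbitSum-∉ i m (mσ∉ ∘ ↭-trans mσ↭m) ⟨
            coeff K (orbitSum i) m ∎

      coeff-combination : ∀ (k : Fin D → Carrier) m →
        coeff K (Σₚ K (λ i → _•_ K (k i) (orbitSum i))) m ≈
        sum (λ i → k i * coeff K (orbitSum i) m)
      coeff-combination k m = trans (coeff-Σₚ (λ i → _•_ K (k i) (orbitSum i)) m)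
        (sum-cong-≋ λ i → coeff-• (k i) (orbitSum i) m)

      -- Classes are disjoint, so a monomial of class `j` sees only the `j`-th orbit sum. Both
      -- independence and spanning rest on this evaluation.
      coeff-combination-∈ : ∀ (k : Fin D → Carrier) j m → InClass j m →
        coeff K (Σₚ K (λ i → _•_ K (k i) (orbitSum i))) m ≈ k j
      coeff-combination-∈ k j m m∈ = begin
        coeff K (Σₚ K (λ i → _•_ K (k i) (orbitSum i))) m   ≈⟨ coeff-combination k m ⟩
        sum (λ i → k i * coeff K (orbitSum i) m)            ≈⟨ sum-single j _ other ⟩
        k j * coeff K (orbitSum j) m                        ≈⟨ *-congˡ (coeff-orbitSum-∈ j m m∈) ⟩
        k j * 1#                                            ≈⟨ *-identityʳ (k j) ⟩
        k j                                                 ∎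
        where
        other : ∀ i → i ≢ j → k i * coeff K (orbitSum i) m ≈ 0#
        other i i≢j = trans
          (*-congˡ (coeff-orbitSum-∉ i m λ m∈′ → i≢j (InClass-unique {m = m} m∈′ m∈))) (zeroʳ (k i))

      representative : ∀ i → Σ[ m ∈ Mon (suc n) ] InClass i m
      representative i with m , eq ← cells-surjective (rep i) (Weight.length≡ (proj₂ (rep∈ i))) =
        m , ↭-reflexive eq

      coeff-∉P : ∀ f → V (suc n) a b f → ∀ m → ¬ P (suc n) a b (cells m) → coeff K f m ≈ 0#
      coeff-∉P f ((_ , f-inv) , bidegree) m ¬Pm with bidegree? a b m
      ... | yes (da , db) = coeff-bad p∣r ζ-prim f f-inv m (¬Pm ∘ Good⇒P m da db)
      ... | no ¬ab        = bidegree m ¬ab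

      dimension-∣ : HasDimension K (V (suc n) a b) D
      dimension-∣ = record
        { basis       = orbitSum
        ; inV         = orbitSum∈V
        ; independent = λ k k≈0 i → let m , m∈ = representative i in
            trans (sym (coeff-combination-∈ k i m m∈)) (k≈0 m)
        -- The coordinates of `f` are its coefficients at the representatives; invariance makes the
        -- coefficients constant on each class.
        ; spanning    = λ f f∈V →
            let k = λ i → coeff K f (proj₁ (representative i)) in k , spans f f∈V
        }
        where
        spans : ∀ f → V (suc n) a b f →
          _≈ₚ_ K (Σₚ K (λ i → _•_ K (coeff K f (proj₁ (representative i))) (orbitSum i))) f
        spans f f∈V@((_ , f-inv) , _) m with P? (suc n) a b (cells m)
        ... | yes Pm with j , m∈ ← index Pm = begin
          _                                       ≈⟨ coeff-combination-∈ k j m m∈ ⟩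
          coeff K f (proj₁ (representative j))
            ≈⟨ coeff-↭ f f-inv _ m (↭-trans (proj₂ (representative j)) (↭-sym m∈)) ⟩
          coeff K f m                             ∎
          where k = λ i → coeff K f (proj₁ (representative i))
        ... | no ¬Pm = begin
          _                                            ≈⟨ coeff-combination k m ⟩
          sum (λ i → k i * coeff K (orbitSum i) m)     ≈⟨ sum-zero _ (λ i → trans
            (*-congˡ (coeff-orbitSum-∉ i m (¬Pm ∘ InClass⇒P {i} {m}))) (zeroʳ (k i))) ⟩
          0#                                           ≈⟨ coeff-∉P f f∈V m ¬Pm ⟨
          coeff K f m                                  ∎
          where k = λ i → coeff K f (proj₁ (representative i))

-- The Hilbert series

corollary6p5 : ∀ {c ℓ₁ ℓ₂} (K : HeytingField c ℓ₁ ℓ₂) → CharacteristicZero K →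
    ∀ (r p s : ℕ) .{{_ : NonZero r}} .{{_ : NonZero p}} .{{_ : NonZero s}} →
    (s∣r : s ∣ r) → p ∣ r →
    ∀ (ζ : HeytingField.Carrier K) (ζ-prim : IsPrimitiveRoot K r ζ) →
    let d = d⟨ r , p , s ⟩ in
    Σ[ Hilb ∈ (ℕ → ℕ → ℕ → ℕ) ]
    (∀ n → 1 ≤ n → d ∣ n → IsHilb K (Invariants K r p s n s∣r ζ-prim) (Hilb n)) ×
    (∀ n → 1 ≤ n → ∀ a b →
    Σ[n≥1, d ∣n]uⁿ Hilb n a b ≡ truncate d s (Σₛ p (λ l → ∏∞ (factor r p l))) n a b)
corollary6p5 K _ r p s s∣r p∣r ζ ζ-prim =
  -- The truncation in `q₁` is part of the Hilbert series itself: for `s` not dividing `a` the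
  -- component is zero. The condition `d ∣ n` is then split off from `truncate` by `if-∧`.
  (λ n a b → if does (s ∣? a) then Σₛ p (λ l → ∏∞ (factor r p l)) n a b else 0) , isHilb ,
  λ { (suc n) _ a b → ≡.sym (if-∧ (does (d⟨ r , p , s ⟩ ∣? suc n))) }
  where
  open Dimension K
  isHilb : ∀ n → 1 ≤ n → d⟨ r , p , s ⟩ ∣ n → IsHilb K (Invariants K r p s n s∣r ζ-prim)
    (λ a b → if does (s ∣? a) then Σₛ p (λ l → ∏∞ (factor r p l)) n a b else 0)
  isHilb (suc n) _ d∣n a b with s ∣? a
  ... | yes s∣a = dimension-∣ s∣r p∣r ζ-prim d∣n s∣a
    (Classes-Σₛ∏∞ r p (residue-injective p∣r) (suc n) (s≤s z≤n) a b)
  ... | no s∤a  = dimension-∤ s∣r p∣r ζ-prim s∤a
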